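{- For every partition $\lambda$, with respect to the order $<_2$, \[ \sum_{\sigma\ \Phi\text{ -degenerate}}(-1)^{m(\sigma)}q^{p(\sigma)+\mathrm{maj}(\sigma)}t^{\mathrm{quinv}(\sigma)}x^{|\sigma|}=0, \] the sum being over all $\Phi$-degenerate super fillings of $\mathrm{dg}(\lambda)$.
   Context: Let $\lambda=(\lambda_1\ge\dots\ge\lambda_k>0)$ be a partition; $\mathrm{dg}(\lambda)=\{(r,i):1\le i\le k,1\le r\le\lambda_i\}$, $(r,i)$ being row $r$ from the bottom and column $i$ from the left (columns bottom-justified of heights $\lambda_i$); $\mathrm{leg}((r,i))=\lambda_i-r$. $\mathcal A=\{1,\bar1,2,\bar2,\dots\}$ consists of positive letters $i$ and negative letters $\bar i$, $|i|=|\bar i|=i$, totally ordered by $<_2$: $0<1<2<3<\cdots<\bar3<\bar2<\bar1$. $I(a,b)=1$ if $a>b$ or $a=b$ is negative, and $I(a,b)=0$ if $a<b$ or $a=b$ is positive. A super filling is $\sigma:\mathrm{dg}(\lambda)\to\mathcal A$; a cell $u=(r,i)$, $r>1$, is a descent if $I(\sigma(u),\sigma((r-1,i)))=1$, and $\mathrm{maj}(\sigma)=\sum_{\text{descents }u}(\mathrm{leg}(u)+1)$. A triple is either three cells $(r+1,i),(r,i),(r,j)$ with $i<j$, or (degenerate) two cells $(r,i),(r,j)$ with $i<j$ and $\lambda_i=r$; with $a=\sigma((r+1,i))$ ($a=0$ if degenerate), $b=\sigma((r,i))$, $c=\sigma((r,j))$, it is a quinv triple iff exactly one of $I(a,b)=1$,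 $I(c,b)=0$, $I(a,c)=0$ holds; $\mathrm{quinv}(\sigma)$ is their number. $x^{|\sigma|}=\prod_u x_{|\sigma(u)|}$; $p(\sigma),m(\sigma)$ are the numbers of positive, resp. negative, entries. The reading order goes through rows top to bottom, each row right to left. The distinguished label of $\sigma$ is the smallest positive integer $a$ such that some cell $(r,j)$ has $|\sigma((r,j))|=a$ and $r>a$; the distinguished cell is the first cell in reading order whose entry has absolute value $a$; $\sigma$ is $\Phi$-degenerate if $a$ exists and the distinguished cell belongs to some degenerate triple. -}

module Defs where

open import Data.Bool using (if_then_else_)
open import Data.Fin as Fin using (Fin; toℕ; fromℕ<)
import Data.Fin.Properties as Fin
open import Data.Integer as ℤ using (ℤ; 0ℤ; -1ℤ)
open import Data.List using (List; []; _∷_; _++_; map; concatMap; filter; length; foldr; upTo; allFin; cartesianProduct; cartesianProductWith)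
import Data.List as List
open import Data.List.Membership.Propositional using (_∈_)
open import Data.List.Membership.Propositional.Properties using (∈-lookup; ∈-map⁺; ∈-map⁻; ∈-++⁺ˡ; ∈-++⁺ʳ; ∈-upTo⁺; ∈-cartesianProductWith⁺)
open import Data.List.Relation.Unary.All as All using (All; []; _∷_)
open import Data.List.Relation.Unary.Any using (here)
open import Data.List.Relation.Unary.Linked using (Linked)
open import Data.List.Relation.Unary.Unique.Propositional using (Unique)
import Data.List.Relation.Unary.AllPairs as AllPairs
import Data.List.Relation.Unary.Unique.Propositional.Properties as Unique
open import Data.Maybe using (Maybe; nothing; just)
import Data.Maybe.Properties as Maybe
open import Data.Nat using (ℕ; zero; suc; _+_; _∸_; _≤_; _<_; _≥_; _>_; _≟_; _≤?_; _<?_)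
open import Data.Nat.ListAction using (sum)
open import Data.Nat.Properties using (allUpTo?)
open import Data.Product using (Σ-syntax; ∃; ∃-syntax; _×_; _,_; proj₁; proj₂; uncurry)
import Data.Product.Properties as Product
open import Data.Sum using (_⊎_)
open import Data.Vec using (Vec; []; _∷_; lookup)
open import Function using (_∘_)
open import Level using (0ℓ)
open import Relation.Binary using (DecidableEquality) renaming (Decidable to Decidable₂)
open import Relation.Binary.PropositionalEquality using (_≡_; _≢_; refl; cong)
open import Relation.Nullary using (¬_; Dec; yes; no; does)
open import Relation.Nullary.Decidable using (map′; ¬?; _×-dec_; _⊎-dec_; _→-dec_)
open import Relation.Unary using (Pred; Decidable)

record Partition : Set where
  field
    parts      : List ℕ
    decreasing : Linked _≥_ parts
    positive   : All (_> 0) parts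

  #columns : ℕ
  #columns = length parts

  part : Fin #columns → ℕ
  part = List.lookup parts

-- `pos n` is the letter n+1 and `neg n` is its barred version.
data Letter : Set where
  pos neg : ℕ → Letter

∣_∣ : Letter → ℕ
∣ pos n ∣ = suc n
∣ neg n ∣ = suc n

data Positive : Pred Letter 0ℓ where
  pos : ∀ {n} → Positive (pos n)

data Negative : Pred Letter 0ℓ where
  neg : ∀ {n} → Negative (neg n)

positive? : Decidable Positive
positive? (pos _) = yes pos
positive? (neg _) = no λ ()

negative? : Decidable Negative
negative? (pos _) = no λ ()
negative? (neg _) = yes neg

_≟ˡ_ : DecidableEquality Letter
pos m ≟ˡ pos n = map′ (cong pos) (λ { refl → refl }) (m ≟ n)
pos m ≟ˡ neg n = no λ ()
neg m ≟ˡ pos n = no λ ()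
neg m ≟ˡ neg n = map′ (cong neg) (λ { refl → refl }) (m ≟ n)

-- The alphabet with the extra symbol 0, which is `nothing`.
Letter₀ : Set
Letter₀ = Maybe Letter

data _<₂_ : Letter₀ → Letter₀ → Set where
  0<letter : ∀ {a}           → nothing <₂ just a
  pos<pos  : ∀ {m n} → m < n → just (pos m) <₂ just (pos n)
  pos<neg  : ∀ {m n}         → just (pos m) <₂ just (neg n)
  neg<neg  : ∀ {m n} → n < m → just (neg m) <₂ just (neg n)

_<₂?_ : Decidable₂ _<₂_
nothing      <₂? nothing      = no λ ()
nothing      <₂? just _       = yes 0<letter
just _       <₂? nothing      = no λ ()
just (pos m) <₂? just (pos n) = map′ pos<pos (λ { (pos<pos p) → p }) (m <? n)
just (pos m) <₂? just (neg n) = yes pos<neg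
just (neg m) <₂? just (pos n) = no λ ()
just (neg m) <₂? just (neg n) = map′ neg<neg (λ { (neg<neg p) → p }) (n <? m)

EqualNegative : Letter₀ → Letter₀ → Set
EqualNegative a b = ∃[ l ] a ≡ just l × b ≡ just l × Negative l

equalNegative? : Decidable₂ EqualNegative
equalNegative? nothing  b = no λ ()
equalNegative? (just l) b =
  map′ (λ (b≡l , l<0) → l , refl , b≡l , l<0) (λ { (_ , refl , b≡l , l<0) → b≡l , l<0 })
       (Maybe.≡-dec _≟ˡ_ b (just l) ×-dec negative? l)

I : Letter₀ → Letter₀ → ℕ
I a b = if does ((b <₂? a) ⊎-dec equalNegative? a b) then 1 else 0

-- q^qdeg t^tdeg x₁^α₁ ⋯ x_N^α_N with α = xdeg; N = nvars is arbitrary, so these are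
-- all the monomials in q, t and the infinitely many variables x₁, x₂, ….
record Monomial : Set where
  field
    qdeg tdeg nvars : ℕ
    xdeg            : Vec ℕ nvars

open Monomial public

-- Formal power series, as coefficient functions.
Series : Set
Series = Monomial → ℤ

lettersUpTo : ℕ → List Letter
lettersUpTo N = map pos (upTo N) ++ map neg (upTo N)

vectors : {A : Set} → List A → ∀ n → List (Vec A n)
vectors xs zero    = [] ∷ []
vectors xs (suc n) = cartesianProductWith _∷_ xs (vectors xs n)

columnFillings : ℕ → ∀ hs → List (All (Vec Letter) hs)
columnFillings N []       = [] ∷ []
columnFillings N (h ∷ hs) =
  cartesianProductWith _∷_ (vectors (lettersUpTo N) h) (columnFillings N hs)

∈-lettersUpTo : ∀ {N} a → ∣ a ∣ ≤ N → a ∈ lettersUpTo N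
∈-lettersUpTo     (pos _) n<N = ∈-++⁺ˡ (∈-map⁺ pos (∈-upTo⁺ n<N))
∈-lettersUpTo {N} (neg _) n<N = ∈-++⁺ʳ (map pos (upTo N)) (∈-map⁺ neg (∈-upTo⁺ n<N))

∈-vectors : ∀ {A : Set} {xs : List A} {n} (v : Vec A n) → (∀ i → lookup v i ∈ xs) → v ∈ vectors xs n
∈-vectors []      _   = here refl
∈-vectors (x ∷ v) v∈ =
  ∈-cartesianProductWith⁺ _∷_ (v∈ Fin.zero) (∈-vectors v (v∈ ∘ Fin.suc))

∈-columnFillings : ∀ {N} hs (σ : All (Vec Letter) hs) →
  (∀ i ρ → ∣ lookup (All.lookup σ (∈-lookup i)) ρ ∣ ≤ N) → σ ∈ columnFillings N hs
∈-columnFillings []       []      _  = here refl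
∈-columnFillings (h ∷ hs) (v ∷ σ) σ≤ =
  ∈-cartesianProductWith⁺ _∷_
    (∈-vectors v (λ ρ → ∈-lettersUpTo (lookup v ρ) (σ≤ Fin.zero ρ)))
    (∈-columnFillings hs σ (σ≤ ∘ Fin.suc))

lettersUpTo-unique : ∀ N → Unique (lettersUpTo N)
lettersUpTo-unique N =
  Unique.++⁺ (Unique.map⁺ (λ { refl → refl }) (Unique.upTo⁺ N))
             (Unique.map⁺ (λ { refl → refl }) (Unique.upTo⁺ N))
             disjoint
  where
  disjoint : ∀ {a} → ¬ (a ∈ map pos (upTo N) × a ∈ map neg (upTo N))
  disjoint (a∈pos , a∈neg) with ∈-map⁻ pos a∈pos | ∈-map⁻ neg a∈neg
  ... | _ , _ , refl | _ , _ , ()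

vectors-unique : ∀ {A : Set} {xs : List A} → Unique xs → ∀ n → Unique (vectors xs n)
vectors-unique xs! zero    = [] AllPairs.∷ AllPairs.[]
vectors-unique xs! (suc n) =
  Unique.cartesianProductWith⁺ _∷_ (λ { refl → refl , refl }) xs! (vectors-unique xs! n)

columnFillings-unique : ∀ N hs → Unique (columnFillings N hs)
columnFillings-unique N []       = [] AllPairs.∷ AllPairs.[]
columnFillings-unique N (h ∷ hs) =
  Unique.cartesianProductWith⁺ _∷_ (λ { refl → refl , refl })
    (vectors-unique (lettersUpTo-unique N) h) (columnFillings-unique N hs)

module _ (μ : Partition) where

  open Partition μ

  -- The cell (r , i), column first; Fin is 0-based, `row` is 1-based.
  Cell : Set
  Cell = Σ[ i ∈ Fin #columns ] Fin (part i)

  cells : List Cell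
  cells = concatMap (λ i → map (i ,_) (allFin (part i))) (allFin #columns)

  col : Cell → Fin #columns
  col = proj₁

  row : Cell → ℕ
  row (_ , ρ) = suc (toℕ ρ)

  height : Cell → ℕ
  height u = part (col u)

  leg : Cell → ℕ
  leg u = height u ∸ row u

  -- Meaningful only for row u > 1 (Fin.pred sends zero to zero).
  below : Cell → Cell
  below (i , ρ) = i , Fin.pred ρ

  above : Cell → Maybe Cell
  above (i , ρ) with suc (toℕ ρ) <? part i
  ... | yes ρ+1<μᵢ = just (i , fromℕ< ρ+1<μᵢ)
  ... | no  _      = nothing

  _≟ᶜ_ : DecidableEquality Cell
  _≟ᶜ_ = Product.≡-dec Fin._≟_ Fin._≟_

  anyCell? : {P : Pred Cell 0ℓ} → Decidable P → Dec (∃ P)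
  anyCell? P? =
    map′ (λ (i , ρ , p) → (i , ρ) , p) (λ ((i , ρ) , p) → i , ρ , p)
         (Fin.any? λ i → Fin.any? λ ρ → P? (i , ρ))

  allCell? : {P : Pred Cell 0ℓ} → Decidable P → Dec (∀ u → P u)
  allCell? P? =
    map′ uncurry (λ p i ρ → p (i , ρ))
         (Fin.all? λ i → Fin.all? λ ρ → P? (i , ρ))

  -- A super filling, given column by column, each from bottom to top.
  Filling : Set
  Filling = All (Vec Letter) parts

  infix 9 _⟨_⟩ _⟨_⟩₀

  _⟨_⟩ : Filling → Cell → Letter
  σ ⟨ i , ρ ⟩ = lookup (All.lookup σ (∈-lookup i)) ρ

  _⟨_⟩₀ : Filling → Maybe Cell → Letter₀
  σ ⟨ just u  ⟩₀ = just (σ ⟨ u ⟩)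
  σ ⟨ nothing ⟩₀ = nothing

  Descent : Filling → Pred Cell 0ℓ
  Descent σ u = row u > 1 × I (just (σ ⟨ u ⟩)) (just (σ ⟨ below u ⟩)) ≡ 1

  descent? : ∀ σ → Decidable (Descent σ)
  descent? σ u = (1 <? row u) ×-dec (_ ≟ 1)

  maj : Filling → ℕ
  maj σ = sum (map (λ u → leg u + 1) (filter (descent? σ) cells))

  -- A triple is determined by its cells u = (r , i) and v = (r , j), i < j: its
  -- third cell is the one above u, and it is degenerate if u tops its column.
  Triple : Cell → Cell → Set
  Triple u v = row u ≡ row v × col u Fin.< col v

  triple? : Decidable₂ Triple
  triple? u v = (row u ≟ row v) ×-dec (col u Fin.<? col v)

  DegenerateTriple : Cell → Cell → Set
  DegenerateTriple u v = Triple u v × height u ≡ row u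

  degenerateTriple? : Decidable₂ DegenerateTriple
  degenerateTriple? u v = triple? u v ×-dec (height u ≟ row u)

  -- As I is 0 or 1, the left-hand side counts which of I(a,b) = 1, I(c,b) = 0
  -- and I(a,c) = 0 hold.
  QuinvTriple : Filling → Cell → Cell → Set
  QuinvTriple σ u v = Triple u v × I a b + (1 ∸ I c b) + (1 ∸ I a c) ≡ 1
    where
    a = σ ⟨ above u ⟩₀
    b = just (σ ⟨ u ⟩)
    c = just (σ ⟨ v ⟩)

  quinvTriple? : ∀ σ → Decidable₂ (QuinvTriple σ)
  quinvTriple? σ u v = triple? u v ×-dec (_ ≟ 1)

  quinv : Filling → ℕ
  quinv σ = length (filter (uncurry (quinvTriple? σ)) (cartesianProduct cells cells))

  p : Filling → ℕ
  p σ = length (filter (λ u → positive? (σ ⟨ u ⟩)) cells)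

  m : Filling → ℕ
  m σ = length (filter (λ u → negative? (σ ⟨ u ⟩)) cells)

  -- The exponent of x_k in x^|σ|.
  xExponent : Filling → ℕ → ℕ
  xExponent σ k = length (filter (λ u → ∣ σ ⟨ u ⟩ ∣ ≟ k) cells)

  -- u strictly precedes v in reading order.
  _≺_ : Cell → Cell → Set
  u ≺ v = row v < row u ⊎ (row u ≡ row v × col v Fin.< col u)

  _≺?_ : Decidable₂ _≺_
  u ≺? v = (row v <? row u)
    ⊎-dec ((row u ≟ row v) ×-dec (col v Fin.<? col u))

  LabelCandidate : Filling → Pred ℕ 0ℓ
  LabelCandidate σ a = a > 0 × ∃[ u ] (∣ σ ⟨ u ⟩ ∣ ≡ a × row u > a)

  labelCandidate? : ∀ σ → Decidable (LabelCandidate σ)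
  labelCandidate? σ a =
    (0 <? a) ×-dec anyCell? λ u → (∣ σ ⟨ u ⟩ ∣ ≟ a) ×-dec (a <? row u)

  DistinguishedLabel : Filling → Pred ℕ 0ℓ
  DistinguishedLabel σ a = LabelCandidate σ a × (∀ {b} → b < a → ¬ LabelCandidate σ b)

  distinguishedLabel? : ∀ σ → Decidable (DistinguishedLabel σ)
  distinguishedLabel? σ a =
    labelCandidate? σ a ×-dec allUpTo? (λ b → ¬? (labelCandidate? σ b)) a

  FirstWithLabel : Filling → ℕ → Pred Cell 0ℓ
  FirstWithLabel σ a u = ∣ σ ⟨ u ⟩ ∣ ≡ a × (∀ v → v ≺ u → ∣ σ ⟨ v ⟩ ∣ ≢ a)

  firstWithLabel? : ∀ σ a → Decidable (FirstWithLabel σ a)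
  firstWithLabel? σ a u =
    (∣ σ ⟨ u ⟩ ∣ ≟ a) ×-dec allCell? λ v → (v ≺? u) →-dec ¬? (∣ σ ⟨ v ⟩ ∣ ≟ a)

  DistinguishedCell : Filling → Pred Cell 0ℓ
  DistinguishedCell σ u = ∃[ a ] (DistinguishedLabel σ a × FirstWithLabel σ a u)

  distinguishedCell? : ∀ σ → Decidable (DistinguishedCell σ)
  distinguishedCell? σ u =
    map′ (λ d → ∣ σ ⟨ u ⟩ ∣ , d) (λ { (_ , l , refl , f) → l , refl , f })
         (distinguishedLabel? σ ∣ σ ⟨ u ⟩ ∣ ×-dec firstWithLabel? σ ∣ σ ⟨ u ⟩ ∣ u)

  InDegenerateTriple : Pred Cell 0ℓ
  InDegenerateTriple u = ∃[ v ] ∃[ w ] (DegenerateTriple v w × (u ≡ v ⊎ u ≡ w))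

  inDegenerateTriple? : Decidable InDegenerateTriple
  inDegenerateTriple? u =
    anyCell? λ v → anyCell? λ w →
      degenerateTriple? v w ×-dec ((u ≟ᶜ v) ⊎-dec (u ≟ᶜ w))

  ΦDegenerate : Pred Filling 0ℓ
  ΦDegenerate σ = ∃[ u ] (DistinguishedCell σ u × InDegenerateTriple u)

  Φdegenerate? : Decidable ΦDegenerate
  Φdegenerate? σ = anyCell? λ u → distinguishedCell? σ u ×-dec inDegenerateTriple? u

  -- The exponent vector of x^|σ| is α, followed by zeros.
  HasContent : ∀ {N} → Filling → Vec ℕ N → Set
  HasContent {N} σ α =
    (∀ k → xExponent σ (suc (toℕ k)) ≡ lookup α k) × (∀ u → ∣ σ ⟨ u ⟩ ∣ ≤ N)

  hasContent? : ∀ {N} σ (α : Vec ℕ N) → Dec (HasContent σ α)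
  hasContent? {N} σ α =
    Fin.all? (λ k → xExponent σ (suc (toℕ k)) ≟ lookup α k)
      ×-dec allCell? (λ u → ∣ σ ⟨ u ⟩ ∣ ≤? N)

  -- q^(p(σ)+maj(σ)) t^quinv(σ) x^|σ| is the monomial ν.
  HasMonomial : Filling → Monomial → Set
  HasMonomial σ ν =
    p σ + maj σ ≡ qdeg ν × quinv σ ≡ tdeg ν × HasContent σ (xdeg ν)

  hasMonomial? : Decidable₂ HasMonomial
  hasMonomial? σ ν =
    (p σ + maj σ ≟ qdeg ν) ×-dec (quinv σ ≟ tdeg ν) ×-dec hasContent? σ (xdeg ν)

  fillingsUpTo : ℕ → List Filling
  fillingsUpTo N = columnFillings N parts

  -- The formal power series Σ (-1)^m(σ) q^(p(σ)+maj(σ)) t^quinv(σ) x^|σ| over all super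
  -- fillings σ satisfying P. Fillings contributing to the coefficient of ν have entries
  -- of absolute value at most nvars ν, hence are listed (exactly once) in
  -- fillingsUpTo (nvars ν): see ∈-fillingsUpTo and fillingsUpTo-unique.
  signedSum : ∀ {P : Pred Filling 0ℓ} → Decidable P → Series
  signedSum P? ν =
    foldr ℤ._+_ 0ℤ
      (map (λ σ → -1ℤ ℤ.^ m σ)
        (filter (λ σ → P? σ ×-dec hasMonomial? σ ν) (fillingsUpTo (nvars ν))))

  ∈-fillingsUpTo : ∀ σ {ν} → HasMonomial σ ν → σ ∈ fillingsUpTo (nvars ν)
  ∈-fillingsUpTo σ (_ , _ , _ , σ≤) = ∈-columnFillings parts σ (λ i ρ → σ≤ (i , ρ))

  fillingsUpTo-unique : ∀ N → Unique (fillingsUpTo N)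
  fillingsUpTo-unique N = columnFillings-unique N parts

{-# OPTIONS --safe #-}
module Submission where

-- Let a be the distinguished label and r the row of the distinguished cell. In rows ≥ a no
-- entry is smaller than a in absolute value, so a is the least and ā the greatest letter that
-- occurs there. The columns of height r form a block; call those with top entry a or ā marked.
-- Flipping the sign of the top entry of a marked column preserves p + maj. It changes only
-- the degenerate triples within the block: going from a to ā, quinv grows by the number of
-- block columns on its left and drops by the number of unmarked ones on its right.
--
-- This defect is repaired by moving the flipped entry through unmarked columns. Two adjacent
-- columns of equal height can exchange their top entries: the exchange continues downwards
-- as long as the quinv triple below would otherwise change. This preserves maj, and quinv
-- except for the degenerate triple on top, so a step to the right changes quinv by -1 for a
-- and by +1 for ā. Hence quinv is preserved if an entry with i columns of the block on its
-- left and j unmarked ones on its right is flipped and moved to the position with j columns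
-- of the block on its left. Exactly one marked column, the central one, can do this without
-- passing another marked column, and it is again the central one afterwards; so this is a
-- sign-reversing involution.

open import Defs
open import Data.Fin as Fin using (Fin; zero; suc; toℕ; fromℕ; fromℕ<)
import Data.Fin.Properties as Fin
open import Data.Integer as ℤ using (ℤ; 0ℤ; -1ℤ)
import Data.Integer.Properties as ℤ
open import Data.List using (List; []; _∷_; _++_; [_]; map; filter; length; foldr; head; last; concatMap; allFin; tabulate; cartesianProduct)
import Data.List as List
open import Data.List.Membership.Propositional using (_∈_)
open import Data.List.Membership.Propositional.Properties using (∈-lookup; ∈-map⁺; ∈-map⁻; ∈-filter⁺; ∈-filter⁻)
open import Data.List.Membership.Propositional.Properties.WithK using (unique∧set⇒bag)
open import Data.List.Properties hiding (sum-++)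
open import Data.List.Relation.Binary.BagAndSetEquality using (∼bag⇒↭)
open import Data.List.Relation.Binary.Permutation.Propositional using (_↭_; ↭⇒↭ₛ)
import Data.List.Relation.Binary.Permutation.Propositional.Properties as Perm
import Data.List.Relation.Binary.Permutation.Setoid.Properties as Permₛ
open import Data.List.Relation.Unary.All as All using (All; []; _∷_)
import Data.List.Relation.Unary.All.Properties as All
open import Data.List.Relation.Unary.AllPairs as AllPairs using (AllPairs)
import Data.List.Relation.Unary.AllPairs.Properties as AllPairs
open import Data.List.Relation.Unary.Any as Any using (Any; here; there)
import Data.List.Relation.Unary.Any.Properties as Any
import Data.List.Relation.Unary.Linked.Properties as Linked
open import Data.List.Relation.Unary.Unique.Propositional using (Unique)
import Data.List.Relation.Unary.Unique.Propositional.Properties as Unique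
open import Data.Bool using (if_then_else_)
open import Data.Maybe as Maybe using (just; nothing)
import Data.Maybe.Properties as Maybe
open import Data.Nat using (ℕ; zero; suc; _+_; _*_; _∸_; _≤_; _<_; _≥_; z≤n; s≤s; s≤s⁻¹; _≤?_; _<?_; _≟_)
open import Data.Nat.ListAction using (sum)
open import Data.Nat.ListAction.Properties using (sum-++)
open import Data.Nat.Properties
open import Algebra.Properties.CommutativeSemigroup +-commutativeSemigroup using (interchange; x∙yz≈y∙xz; xy∙z≈xz∙y)
open import Data.Nat.Tactic.RingSolver using (solve-∀)
open import Data.Product using (Σ-syntax; ∃; ∃-syntax; _×_; _,_; proj₁; proj₂; uncurry)
open import Data.Sum as Sum using (_⊎_; inj₁; inj₂)
open import Data.Unit using (⊤; tt)
open import Data.Vec as Vec using (Vec; []; _∷_; lookup; toList)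
open import Data.Vec.Properties using (length-toList; toList∘fromList)
open import Function using (_∘_; _$_; mk⇔)
open import Level using (0ℓ)
open import Relation.Binary.Definitions using (tri<; tri≈; tri>)
open import Relation.Binary.PropositionalEquality using (_≡_; _≢_; refl; sym; trans; cong; cong₂; subst; subst₂; setoid; module ≡-Reasoning)
open import Relation.Nullary using (¬_; Dec; yes; no; does; contradiction)
open import Relation.Nullary.Decidable using (_×-dec_; _⊎-dec_; ¬?; dec-true; dec-false)
open import Relation.Unary using (Pred; Decidable; ∁)

-- Sign-reversing involutions

-- The relation I(a,b) = 1 and its negation are both transitive, so the indicator of a quinv triple
-- equals I(c,b) + I(a,c) - I(a,b). Everything about exchanges and flips follows from this linear
-- form by cancellation; for instance, an extreme letter on top of a triple contributes equally to
-- I(a,c) and I(a,b). Since r > a strictly, the row below the distinguished cell still has index at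
-- least a, so a and ā are extreme there as well. The flip therefore turns the top cell into a
-- descent of weight 1, which pays for the lost positive letter. The central column comes from a
-- crossing argument: from one mark to the next, the number of columns on the left grows, while the
-- number of unmarked ones on the right does not. Iterated exchanges have no convenient closed
-- formula, so the involution is a relation. Two partners arise from a common origin, the flipped
-- column standing at the left end of its run of unmarked columns, and the origin can be recovered
-- from either of them.

sumℤ : List ℤ → ℤ
sumℤ = foldr ℤ._+_ 0ℤ

sumℤ-↭ : ∀ {xs ys} → xs ↭ ys → sumℤ xs ≡ sumℤ ys
sumℤ-↭ p = Permₛ.foldr-commMonoid (setoid ℤ) ℤ.+-0-isCommutativeMonoid (↭⇒↭ₛ p)

x≡-x⇒x≡0 : ∀ x → x ≡ ℤ.- x → x ≡ 0ℤ
x≡-x⇒x≡0 (ℤ.+ zero) _ = refl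

sumℤ-negate : ∀ {A : Set} (f g : A → ℤ) xs → (∀ {x} → x ∈ xs → g x ≡ ℤ.- f x) →
  sumℤ (map g xs) ≡ ℤ.- sumℤ (map f xs)
sumℤ-negate f g []       _  = refl
sumℤ-negate f g (x ∷ xs) eq =
  trans (cong₂ ℤ._+_ (eq (here refl)) (sumℤ-negate f g xs (eq ∘ there)))
        (sym (ℤ.neg-distrib-+ (f x) _))

unique-map : ∀ {A : Set} (φ : A → A) {xs : List A} → Unique xs →
  (∀ {x} → x ∈ xs → φ (φ x) ≡ x) → Unique (map φ xs)
unique-map φ AllPairs.[]           _    = AllPairs.[]
unique-map φ (x∉ AllPairs.∷ xs!) φφ =
  All.map⁺ (All.tabulate λ {y} y∈ φx≡φy → All.lookup x∉ y∈
    (trans (sym (φφ (here refl))) (trans (cong φ φx≡φy) (φφ (there y∈)))))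
  AllPairs.∷ unique-map φ xs! (φφ ∘ there)

-- The list is a permutation of its image under φ, so the sum equals its own negative, and ℤ has no
-- 2-torsion. Summands never have to be paired off explicitly.
sum-involution : ∀ {A : Set} (f : A → ℤ) (φ : A → A) {xs : List A} → Unique xs →
  (∀ {x} → x ∈ xs → φ x ∈ xs) →
  (∀ {x} → x ∈ xs → φ (φ x) ≡ x) →
  (∀ {x} → x ∈ xs → f (φ x) ≡ ℤ.- f x) →
  sumℤ (map f xs) ≡ 0ℤ
sum-involution f φ {xs} xs! φ∈ φφ fφ = x≡-x⇒x≡0 _ $ begin
  sumℤ (map f xs)          ≡⟨ sumℤ-↭ (Perm.map⁺ f xs↭φxs) ⟩
  sumℤ (map f (map φ xs))  ≡⟨ cong sumℤ (map-∘ xs) ⟨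
  sumℤ (map (f ∘ φ) xs)    ≡⟨ sumℤ-negate f (f ∘ φ) xs fφ ⟩
  ℤ.- sumℤ (map f xs)      ∎
  where
  open ≡-Reasoning
  xs↭φxs : xs ↭ map φ xs
  xs↭φxs = ∼bag⇒↭ (unique∧set⇒bag xs! (unique-map φ xs! φφ) (mk⇔
    (λ x∈ → subst (_∈ map φ xs) (φφ x∈) (∈-map⁺ φ (φ∈ x∈)))
    (λ x∈ → let _ , y∈ , eq = ∈-map⁻ φ x∈ in subst (_∈ xs) (sym eq) (φ∈ y∈))))

++-injective : ∀ {A : Set} (xs xs′ : List A) {ys ys′} → length xs ≡ length xs′ →
  xs ++ ys ≡ xs′ ++ ys′ → xs ≡ xs′ × ys ≡ ys′
++-injective []       []         _  eq = refl , eq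
++-injective (x ∷ xs) (x′ ∷ xs′) ∣∣ eq with refl ← ∷-injectiveˡ eq =
  let eq₁ , eq₂ = ++-injective xs xs′ (suc-injective ∣∣) (∷-injectiveʳ eq) in cong (x ∷_) eq₁ , eq₂

-- The marked element of a list that is moved by the involution

module Marks {C : Set} {A : Pred C 0ℓ} (A? : Decidable A) where

  #plain : List C → ℕ
  #plain xs = length (filter (¬? ∘ A?) xs)

  Plain : List C → Set
  Plain = All (∁ A)

  #plain-++ : ∀ xs ys → #plain (xs ++ ys) ≡ #plain xs + #plain ys
  #plain-++ xs ys = trans (cong length (filter-++ (¬? ∘ A?) xs ys)) (length-++ (filter (¬? ∘ A?) xs))

  #plain-Plain : ∀ {xs} → Plain xs → #plain xs ≡ length xs
  #plain-Plain pl = cong length (filter-all (¬? ∘ A?) pl)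

  #plain-A : ∀ {z} xs → A z → #plain (z ∷ xs) ≡ #plain xs
  #plain-A xs Az = cong length (filter-reject (¬? ∘ A?) (λ ¬Az → ¬Az Az))

  EndsMarked StartsMarked : List C → Set
  EndsMarked   xs = xs ≡ [] ⊎ ∃[ ys ] ∃[ z ] xs ≡ ys ++ [ z ] × A z
  StartsMarked xs = xs ≡ [] ⊎ ∃[ z ] ∃[ ys ] xs ≡ z ∷ ys × A z

  -- The target position of z has as many elements on its left as there are plain ones on its right,
  -- that is `length S + #plain T`. The two bounds place this number between `length P` and
  -- `length P + length Q + length S`, the range that z can reach without passing a mark.
  record Central (P Q : List C) (z : C) (S T : List C) : Set where
    field
      marked   : A z
      plainˡ   : Plain Q
      plainʳ   : Plain S
      ends     : EndsMarked P
      starts   : StartsMarked T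
      boundˡ   : length P ≤ length S + #plain T
      boundʳ   : #plain T ≤ length P + length Q

  data Compare (xs : List C) (z : C) (ys xs′ : List C) (z′ : C) (ys′ : List C) : Set where
    same   : xs ≡ xs′ → z ≡ z′ → ys ≡ ys′ → Compare xs z ys xs′ z′ ys′
    before : ∀ M → xs′ ≡ xs ++ z ∷ M → ys ≡ M ++ z′ ∷ ys′ → Compare xs z ys xs′ z′ ys′
    after  : ∀ M → xs ≡ xs′ ++ z′ ∷ M → ys′ ≡ M ++ z ∷ ys → Compare xs z ys xs′ z′ ys′

  compare : ∀ xs {z ys} xs′ {z′ ys′} → xs ++ z ∷ ys ≡ xs′ ++ z′ ∷ ys′ → Compare xs z ys xs′ z′ ys′
  compare []       []         refl = same refl refl refl
  compare []       (x ∷ xs′)  refl = before xs′ refl refl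
  compare (x ∷ xs) []         refl = after xs refl refl
  compare (x ∷ xs) (x′ ∷ xs′) eq with refl ← ∷-injectiveˡ eq | compare xs xs′ (∷-injectiveʳ eq)
  ... | same refl refl refl = same refl refl refl
  ... | before M refl refl  = before M refl refl
  ... | after M refl refl   = after M refl refl

  marked-in-prefix : ∀ P {Q} N {z M} → Plain Q → A z → P ++ Q ≡ N ++ z ∷ M → length N < length P
  marked-in-prefix []      []      (¬z ∷ _)  Az refl = contradiction Az ¬z
  marked-in-prefix []      (_ ∷ N) (_ ∷ pl)  Az refl = contradiction Az (All.head (All.++⁻ʳ N pl))
  marked-in-prefix (_ ∷ P) []      pl        Az eq   = s≤s z≤n
  marked-in-prefix (_ ∷ P) (_ ∷ N) pl        Az eq   = s≤s (marked-in-prefix P N pl Az (∷-injectiveʳ eq))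

  plain-in-prefix : ∀ S {T} M {z Y} → Plain S → A z → S ++ T ≡ M ++ z ∷ Y → length S ≤ length M
  plain-in-prefix []      M       pl        Az eq   = z≤n
  plain-in-prefix (s ∷ S) []      (¬s ∷ pl) Az refl = contradiction Az ¬s
  plain-in-prefix (s ∷ S) (_ ∷ M) (¬s ∷ pl) Az eq   = s≤s (plain-in-prefix S M pl Az (∷-injectiveʳ eq))

  #plain-suffix : ∀ S {T} M {z Y} → Plain S → A z → S ++ T ≡ M ++ z ∷ Y → #plain Y ≤ #plain T
  #plain-suffix []      M {z} {Y} pl Az refl = begin
    #plain Y                     ≡⟨ #plain-A Y Az ⟨
    #plain (z ∷ Y)               ≤⟨ m≤n+m _ (#plain M) ⟩
    #plain M + #plain (z ∷ Y)    ≡⟨ #plain-++ M (z ∷ Y) ⟨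
    #plain (M ++ z ∷ Y)          ∎
    where open ≤-Reasoning
  #plain-suffix (s ∷ S) []      (¬s ∷ pl) Az refl = contradiction Az ¬s
  #plain-suffix (s ∷ S) (_ ∷ M) (¬s ∷ pl) Az eq   = #plain-suffix S M pl Az (∷-injectiveʳ eq)

  -- A marked element right of a central one is not central: the plain elements on its
  -- right are too few to compensate the elements on its left.
  not-before : ∀ {P Q z S T P′ Q′ z′ S′ T′} → Central P Q z S T → Central P′ Q′ z′ S′ T′ →
    ∀ M → P′ ++ Q′ ≡ (P ++ Q) ++ z ∷ M → ¬ S ++ T ≡ M ++ z′ ∷ (S′ ++ T′)
  not-before {P} {Q} {z} {S} {T} {P′} {Q′} {z′} {S′} {T′} c c′ M eq₁ eq₂ = <-irrefl refl $ begin-strict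
    #plain T                  ≤⟨ boundʳ c ⟩
    length P + length Q       ≡⟨ length-++ P ⟨
    length (P ++ Q)           <⟨ marked-in-prefix P′ (P ++ Q) (plainˡ c′) (marked c) eq₁ ⟩
    length P′                 ≤⟨ boundˡ c′ ⟩
    length S′ + #plain T′     ≡⟨ cong (_+ #plain T′) (#plain-Plain (plainʳ c′)) ⟨
    #plain S′ + #plain T′     ≡⟨ #plain-++ S′ T′ ⟨
    #plain (S′ ++ T′)         ≤⟨ #plain-suffix S M (plainʳ c) (marked c′) eq₂ ⟩
    #plain T                  ∎
    where
    open ≤-Reasoning
    open Central

  private
    ends-≤ : ∀ {P Q P′ Q′} → EndsMarked P → Plain Q′ → P ++ Q ≡ P′ ++ Q′ → length P ≤ length P′
    ends-≤ (inj₁ refl) _ _ = z≤n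
    ends-≤ {Q = Q} {P′} (inj₂ (P , z , refl , Az)) pl eq = begin
      length (P ++ [ z ])  ≡⟨ length-++ P ⟩
      length P + 1         ≡⟨ +-comm (length P) 1 ⟩
      suc (length P)       ≤⟨ marked-in-prefix P′ P pl Az (trans (sym eq) (++-assoc P [ z ] Q)) ⟩
      length P′            ∎
      where open ≤-Reasoning

    starts-≤ : ∀ {S T S′ T′} → StartsMarked T′ → Plain S → S ++ T ≡ S′ ++ T′ → length S ≤ length S′
    starts-≤ {S} {T} {S′} (inj₁ refl) _ eq = begin
      length S                ≤⟨ m≤m+n _ _ ⟩
      length S + length T     ≡⟨ length-++ S ⟨
      length (S ++ T)         ≡⟨ cong length (trans eq (++-identityʳ S′)) ⟩
      length S′               ∎
      where open ≤-Reasoning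
    starts-≤ {S} {T} {S′} (inj₂ (_ , _ , refl , Az)) pl eq = plain-in-prefix S S′ pl Az eq

  -- `not-before`, used in both directions, fixes the position of z. Then Q and S are the longest
  -- plain runs next to z, because P and T are empty or have a mark at the end facing z.
  central-unique : ∀ {P Q z S T P′ Q′ z′ S′ T′} → Central P Q z S T → Central P′ Q′ z′ S′ T′ →
    (P ++ Q) ++ z ∷ (S ++ T) ≡ (P′ ++ Q′) ++ z′ ∷ (S′ ++ T′) →
    P ≡ P′ × Q ≡ Q′ × z ≡ z′ × S ≡ S′ × T ≡ T′
  central-unique {P} {Q} {S = S} {P′ = P′} {Q′} {S′ = S′} c c′ eq with compare (P ++ Q) (P′ ++ Q′) eq
  ... | before M eq₁ eq₂ = contradiction eq₂ (not-before c c′ M eq₁)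
  ... | after M eq₁ eq₂  = contradiction eq₂ (not-before c′ c M eq₁)
  ... | same eq₁ z≡z′ eq₂ =
    let P≡ , Q≡ = ++-injective P P′ (≤-antisym (ends-≤ (ends c) (plainˡ c′) eq₁)
                                              (ends-≤ (ends c′) (plainˡ c) (sym eq₁))) eq₁
        S≡ , T≡ = ++-injective S S′ (≤-antisym (starts-≤ (starts c′) (plainʳ c) eq₂)
                                              (starts-≤ (starts c) (plainʳ c′) (sym eq₂))) eq₂
    in P≡ , Q≡ , z≡z′ , S≡ , T≡
    where open Central

  splitPlain : ∀ xs → ∃[ S ] ∃[ T ] xs ≡ S ++ T × Plain S × StartsMarked T
  splitPlain []       = [] , [] , refl , [] , inj₁ refl
  splitPlain (x ∷ xs) with A? x
  ... | yes Ax = [] , x ∷ xs , refl , [] , inj₂ (x , xs , refl , Ax)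
  ... | no ¬Ax = let S , T , eq , pl , st = splitPlain xs in x ∷ S , T , cong (x ∷_) eq , ¬Ax ∷ pl , st

  #afterMark : List C → ℕ
  #afterMark []       = 0
  #afterMark (x ∷ xs) with A? x
  ... | yes _ = #plain xs
  ... | no  _ = #afterMark xs

  #afterMark-Plain : ∀ {S} T → Plain S → #afterMark (S ++ T) ≡ #afterMark T
  #afterMark-Plain T [] = refl
  #afterMark-Plain T (_∷_ {x} ¬x pl) with A? x
  ... | yes Ax = contradiction Ax ¬x
  ... | no _   = #afterMark-Plain T pl

  #afterMark-A : ∀ {z} T → A z → #afterMark (z ∷ T) ≡ #plain T
  #afterMark-A {z} T Az with A? z
  ... | yes _  = refl
  ... | no ¬Az = contradiction Az ¬Az

  nextMark : ∀ W N → (∃[ S ] ∃[ T ] W ≡ S ++ T × Plain S × StartsMarked T × #plain T ≤ N)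
                     ⊎ (Any A W × N < #afterMark W)
  nextMark W N with splitPlain W
  ... | S , T , refl , pl , st with #plain T ≤? N
  ...   | yes le = inj₁ (S , T , refl , pl , st , le)
  ...   | no ≰ with st
  ...     | inj₁ refl = contradiction z≤n ≰
  ...     | inj₂ (z , T₀ , refl , Az) = inj₂ (Any.++⁺ʳ S (here Az) , N<)
    where
    open ≤-Reasoning
    N< : N < #afterMark (S ++ z ∷ T₀)
    N< = begin-strict
      N                            <⟨ ≰⇒> ≰ ⟩
      #plain (z ∷ T₀)              ≡⟨ #plain-A T₀ Az ⟩
      #plain T₀                    ≡⟨ #afterMark-A T₀ Az ⟨
      #afterMark (z ∷ T₀)          ≡⟨ #afterMark-Plain (z ∷ T₀) pl ⟨
      #afterMark (S ++ z ∷ T₀)     ∎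

  private
    -- The scan visits the marks from left to right; the invariant on `length P` is `boundˡ` for the
    -- next mark. If `boundʳ` fails at a mark, then more than `length P + length Q` plain elements
    -- lie beyond the following mark, which is `boundˡ` for that one. At the last mark `boundʳ`
    -- holds trivially, so the scan succeeds.
    central-scan : ∀ P Q W → EndsMarked P → Plain Q → Any A W → length P ≤ #afterMark W →
      ∃[ P′ ] ∃[ Q′ ] ∃[ z ] ∃[ S ] ∃[ T ]
        (P ++ Q) ++ W ≡ (P′ ++ Q′) ++ z ∷ (S ++ T) × Central P′ Q′ z S T
    central-scan P Q (w ∷ W) end pl any bound with A? w
    central-scan P Q (w ∷ W) end pl (here Aw) bound | no ¬Aw = contradiction Aw ¬Aw
    central-scan P Q (w ∷ W) end pl (there any) bound | no ¬Aw =
      let P′ , Q′ , z , S , T , eq , c = central-scan P (Q ++ [ w ]) W end (All.++⁺ pl (¬Aw ∷ [])) any bound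
      in P′ , Q′ , z , S , T ,
         trans (sym (trans (cong (_++ W) (sym (++-assoc P Q [ w ]))) (++-assoc (P ++ Q) [ w ] W))) eq , c
    central-scan P Q (w ∷ W) end pl any bound | yes Aw with nextMark W (length P + length Q)
    ... | inj₁ (S , T , eq , plS , st , le) = P , Q , w , S , T , cong (λ W → (P ++ Q) ++ w ∷ W) eq , record
      { marked = Aw ; plainˡ = pl ; plainʳ = plS ; ends = end ; starts = st
      ; boundˡ = subst (length P ≤_)
          (trans (cong #plain eq) (trans (#plain-++ S T) (cong (_+ #plain T) (#plain-Plain plS)))) bound
      ; boundʳ = le }
    ... | inj₂ (any′ , N<) =
      let P′ , Q′ , z , S , T , eq , c = central-scan ((P ++ Q) ++ [ w ]) [] W
            (inj₂ (P ++ Q , w , refl , Aw)) [] any′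
            (subst (_≤ #afterMark W)
              (sym (trans (length-++ (P ++ Q)) (trans (+-comm _ 1) (cong suc (length-++ P))))) N<)
      in P′ , Q′ , z , S , T ,
         trans (sym (trans (cong (_++ W) (++-identityʳ ((P ++ Q) ++ [ w ]))) (++-assoc (P ++ Q) [ w ] W))) eq , c

  central-exists : ∀ {W} → Any A W →
    ∃[ P ] ∃[ Q ] ∃[ z ] ∃[ S ] ∃[ T ] W ≡ (P ++ Q) ++ z ∷ (S ++ T) × Central P Q z S T
  central-exists any = central-scan [] [] _ (inj₁ refl) [] any z≤n

-- The comparison of letters

𝟙 : ∀ {P : Set} → Dec P → ℕ
𝟙 P? = if does P? then 1 else 0

𝟙-yes : ∀ {P : Set} (P? : Dec P) → P → 𝟙 P? ≡ 1
𝟙-yes P? p = cong (if_then 1 else 0) (dec-true P? p)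

𝟙-no : ∀ {P : Set} (P? : Dec P) → ¬ P → 𝟙 P? ≡ 0
𝟙-no P? ¬p = cong (if_then 1 else 0) (dec-false P? ¬p)

𝟙-01 : ∀ {P : Set} (P? : Dec P) → 𝟙 P? ≡ 0 ⊎ 𝟙 P? ≡ 1
𝟙-01 (yes _) = inj₂ refl
𝟙-01 (no _)  = inj₁ refl

infix 4 _▷_

-- The relation I(x,y) = 1 between letters: irreflexive on positive letters, reflexive on negative
-- ones. The order of the negative letters is reversed, whence m ≤ n in `neg▷neg`.
data _▷_ : Letter → Letter → Set where
  pos▷pos : ∀ {m n} → n < m → pos m ▷ pos n
  neg▷pos : ∀ {m n} → neg m ▷ pos n
  neg▷neg : ∀ {m n} → m ≤ n → neg m ▷ neg n

_▷?_ : ∀ x y → Dec (x ▷ y)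
pos m ▷? pos n with suc n ≤? m
... | yes lt = yes (pos▷pos lt)
... | no ≮   = no λ { (pos▷pos lt) → ≮ lt }
pos m ▷? neg n = no λ ()
neg m ▷? pos n = yes neg▷pos
neg m ▷? neg n with m ≤? n
... | yes le = yes (neg▷neg le)
... | no ≰   = no λ { (neg▷neg le) → ≰ le }

-- Abstract, so that unification never unfolds the decision procedures behind I.
abstract
  J : Letter₀ → Letter → ℕ
  J a b = I a (just b)

  J≡I : ∀ a b → J a b ≡ I a (just b)
  J≡I a b = refl

  J-nothing : ∀ b → J nothing b ≡ 0
  J-nothing b = refl

▷⇒J : ∀ {x y} → x ▷ y → J (just x) y ≡ 1
▷⇒J {x} {y} x▷y = trans (J≡I _ _) $ 𝟙-yes ((just y <₂? just x) ⊎-dec equalNegative? (just x) (just y)) (holds x▷y)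
  where
  holds : ∀ {x y} → x ▷ y → just y <₂ just x ⊎ EqualNegative (just x) (just y)
  holds (pos▷pos lt) = inj₁ (pos<pos lt)
  holds neg▷pos      = inj₁ pos<neg
  holds (neg▷neg le) with m≤n⇒m<n∨m≡n le
  ... | inj₁ lt   = inj₁ (neg<neg lt)
  ... | inj₂ refl = inj₂ (_ , refl , refl , neg)

⋫⇒J : ∀ {x y} → ¬ x ▷ y → J (just x) y ≡ 0
⋫⇒J {x} {y} x⋫y = trans (J≡I _ _) $ 𝟙-no ((just y <₂? just x) ⊎-dec equalNegative? (just x) (just y)) λ
  { (inj₁ (pos<pos lt))            → x⋫y (pos▷pos lt)
  ; (inj₁ pos<neg)                 → x⋫y neg▷pos
  ; (inj₁ (neg<neg lt))            → x⋫y (neg▷neg (<⇒≤ lt))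
  ; (inj₂ (_ , refl , refl , neg)) → x⋫y (neg▷neg ≤-refl) }

▷-trans : ∀ {x y z} → x ▷ y → y ▷ z → x ▷ z
▷-trans (pos▷pos lt) (pos▷pos lt′) = pos▷pos (<-trans lt′ lt)
▷-trans neg▷pos      (pos▷pos _)   = neg▷pos
▷-trans (neg▷neg _)  neg▷pos       = neg▷pos
▷-trans (neg▷neg le) (neg▷neg le′) = neg▷neg (≤-trans le le′)

▷-cotrans : ∀ {x z} → x ▷ z → ∀ y → x ▷ y ⊎ y ▷ z
▷-cotrans {pos l} {pos n} (pos▷pos n<l) (pos m) with suc n ≤? m
... | yes n<m = inj₂ (pos▷pos n<m)
... | no n≮m  = inj₁ (pos▷pos (≤-<-trans (≮⇒≥ n≮m) n<l))
▷-cotrans (pos▷pos _) (neg _) = inj₂ neg▷pos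
▷-cotrans neg▷pos     (pos _) = inj₁ neg▷pos
▷-cotrans neg▷pos     (neg _) = inj₂ neg▷pos
▷-cotrans (neg▷neg _) (pos _) = inj₁ neg▷pos
▷-cotrans {neg l} {neg n} (neg▷neg l≤n) (neg m) with m ≤? n
... | yes m≤n = inj₂ (neg▷neg m≤n)
... | no m≰n  = inj₁ (neg▷neg (≤-trans l≤n (<⇒≤ (≰⇒> m≰n))))

J-antisym : ∀ {x y} → x ≢ y → J (just x) y + J (just y) x ≡ 1
J-antisym {x} {y} x≢y with x ▷? y | y ▷? x
... | yes p | no ¬q = cong₂ _+_ (▷⇒J p) (⋫⇒J ¬q)
... | no ¬p | yes q = cong₂ _+_ (⋫⇒J ¬p) (▷⇒J q)
... | yes p | yes q = contradiction (antisym p q) x≢y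
  where
  antisym : ∀ {x y} → x ▷ y → y ▷ x → x ≡ y
  antisym (pos▷pos lt) (pos▷pos lt′) = contradiction lt′ (<-asym lt)
  antisym (neg▷neg le) (neg▷neg le′) = cong neg (≤-antisym le le′)
... | no ¬p | no ¬q = contradiction (total x y ¬p ¬q) x≢y
  where
  total : ∀ x y → ¬ x ▷ y → ¬ y ▷ x → x ≡ y
  total (pos m) (pos n) ¬p ¬q = cong pos (≤-antisym (≮⇒≥ (¬p ∘ pos▷pos)) (≮⇒≥ (¬q ∘ pos▷pos)))
  total (pos m) (neg n) ¬p ¬q = contradiction neg▷pos ¬q
  total (neg m) (pos n) ¬p ¬q = contradiction neg▷pos ¬p
  total (neg m) (neg n) ¬p ¬q = cong neg (≤-antisym (<⇒≤ (≰⇒> (¬q ∘ neg▷neg))) (<⇒≤ (≰⇒> (¬p ∘ neg▷neg))))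

abstract
  quinv₃ : Letter₀ → Letter → Letter → ℕ
  quinv₃ a b c = 𝟙 (J a b + (1 ∸ J (just c) b) + (1 ∸ J a c) ≟ 1)

  quinv₃≡𝟙 : ∀ a b c → quinv₃ a b c ≡ 𝟙 (J a b + (1 ∸ J (just c) b) + (1 ∸ J a c) ≟ 1)
  quinv₃≡𝟙 a b c = refl

  -- Transitivity of I and of its negation: either one or two of the three conditions
  -- defining a quinv triple hold, so being a quinv triple is a linear condition.
  quinv₃-linear : ∀ a b c → quinv₃ a b c + J a b ≡ J (just c) b + J a c
  quinv₃-linear nothing b c with c ▷? b
  ... | yes q rewrite J-nothing b | J-nothing c | ▷⇒J q = refl
  ... | no ¬q rewrite J-nothing b | J-nothing c | ⋫⇒J ¬q = refl
  quinv₃-linear (just a) b c with a ▷? b | c ▷? b | a ▷? c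
  ... | yes p | yes q | yes r rewrite ▷⇒J p | ▷⇒J q | ▷⇒J r = refl
  ... | yes p | yes q | no ¬r rewrite ▷⇒J p | ▷⇒J q | ⋫⇒J ¬r = refl
  ... | yes p | no ¬q | yes r rewrite ▷⇒J p | ⋫⇒J ¬q | ▷⇒J r = refl
  ... | no ¬p | yes q | no ¬r rewrite ⋫⇒J ¬p | ▷⇒J q | ⋫⇒J ¬r = refl
  ... | no ¬p | no ¬q | yes r rewrite ⋫⇒J ¬p | ⋫⇒J ¬q | ▷⇒J r = refl
  ... | no ¬p | no ¬q | no ¬r rewrite ⋫⇒J ¬p | ⋫⇒J ¬q | ⋫⇒J ¬r = refl
  ... | no ¬p | yes q | yes r = contradiction (▷-trans r q) ¬p
  ... | yes p | no ¬q | no ¬r with ▷-cotrans p c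
  ...   | inj₁ r = contradiction r ¬r
  ...   | inj₂ q = contradiction q ¬q

  quinv₃-01 : ∀ a b c → quinv₃ a b c ≡ 0 ⊎ quinv₃ a b c ≡ 1
  quinv₃-01 a b c = 𝟙-01 (J a b + (1 ∸ J (just c) b) + (1 ∸ J a c) ≟ 1)

quinv₃-diagonal : ∀ a a′ b → quinv₃ a b b ≡ quinv₃ a′ b b
quinv₃-diagonal a a′ b = trans (diagonal a) (sym (diagonal a′))
  where
  diagonal : ∀ a → quinv₃ a b b ≡ J (just b) b
  diagonal a = +-cancelʳ-≡ (J a b) _ _ (quinv₃-linear a b b)

-- When the linear identities for (b , c) and (c , b) are added, the terms containing `a` cancel and
-- J c b + J b c = 1 remains.
quinv₃-antisym : ∀ a {b c} → b ≢ c → quinv₃ a b c + quinv₃ a c b ≡ 1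
quinv₃-antisym a {b} {c} b≢c = +-cancelʳ-≡ (J a b + J a c) _ _ $ begin
  (quinv₃ a b c + quinv₃ a c b) + (J a b + J a c)
    ≡⟨ interchange (quinv₃ a b c) _ _ _ ⟩
  (quinv₃ a b c + J a b) + (quinv₃ a c b + J a c)
    ≡⟨ cong₂ _+_ (quinv₃-linear a b c) (quinv₃-linear a c b) ⟩
  (J (just c) b + J a c) + (J (just b) c + J a b)
    ≡⟨ interchange (J (just c) b) _ _ _ ⟩
  (J (just c) b + J (just b) c) + (J a c + J a b)
    ≡⟨ cong₂ _+_ (J-antisym (b≢c ∘ sym)) (+-comm (J a c) _) ⟩
  1 + (J a b + J a c)  ∎
  where
  open ≡-Reasoning

-- The hypothesis forces b ≢ c, as quinv₃ a b b does not depend on a.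
quinv₃-swap : ∀ a a′ b c → quinv₃ a b c ≢ quinv₃ a′ b c → quinv₃ a′ c b ≡ quinv₃ a b c
quinv₃-swap a a′ b c ≢′ = +-cancelˡ-≡ (quinv₃ a′ b c) _ _ $
  trans (quinv₃-antisym a′ b≢c) (sym (sum≡1 (quinv₃-01 a b c) (quinv₃-01 a′ b c)))
  where
  b≢c : b ≢ c
  b≢c refl = ≢′ (quinv₃-diagonal a a′ b)
  sum≡1 : quinv₃ a b c ≡ 0 ⊎ quinv₃ a b c ≡ 1 → quinv₃ a′ b c ≡ 0 ⊎ quinv₃ a′ b c ≡ 1 →
    quinv₃ a′ b c + quinv₃ a b c ≡ 1
  sum≡1 (inj₁ x) (inj₁ y) = contradiction (trans x (sym y)) ≢′
  sum≡1 (inj₁ x) (inj₂ y) = cong₂ _+_ y x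
  sum≡1 (inj₂ x) (inj₁ y) = cong₂ _+_ y x
  sum≡1 (inj₂ x) (inj₂ y) = contradiction (trans x (sym y)) ≢′

-- Letters of the smallest absolute value are extreme

J-least : ∀ {n x} → suc n ≤ ∣ x ∣ → J (just (pos n)) x ≡ 0
J-least {x = pos m} (s≤s n≤m) = ⋫⇒J λ { (pos▷pos m<n) → <⇒≱ m<n n≤m }
J-least {x = neg m} _         = ⋫⇒J λ ()

J-greatest : ∀ {n x} → suc n ≤ ∣ x ∣ → J (just (neg n)) x ≡ 1
J-greatest {x = pos m} _         = ▷⇒J neg▷pos
J-greatest {x = neg m} (s≤s n≤m) = ▷⇒J (neg▷neg n≤m)

J-above-least : ∀ {n x} → suc n < ∣ x ∣ → J (just x) (pos n) ≡ 1
J-above-least {x = pos m} (s≤s n<m) = ▷⇒J (pos▷pos n<m)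
J-above-least {x = neg m} _         = ▷⇒J neg▷pos

J-below-greatest : ∀ {n x} → suc n < ∣ x ∣ → J (just x) (neg n) ≡ 0
J-below-greatest {x = pos m} _         = ⋫⇒J λ ()
J-below-greatest {x = neg m} (s≤s n<m) = ⋫⇒J λ { (neg▷neg m≤n) → <⇒≱ n<m m≤n }

-- Between letters of equal absolute value only the sign of the first one counts. Hence flipping a
-- marked top does not affect its degenerate triples with marked columns further right.
J-equal : ∀ {n x} → ∣ x ∣ ≡ suc n → J (just x) (neg n) ≡ J (just x) (pos n)
J-equal {x = pos m} refl = trans (⋫⇒J λ ()) (sym (⋫⇒J λ { (pos▷pos m<m) → <-irrefl refl m<m }))
J-equal {x = neg m} refl = trans (▷⇒J (neg▷neg ≤-refl)) (sym (▷⇒J neg▷pos))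

-- Fillings as lists of columns, each from bottom to top

Column : Set
Column = List Letter

-- The triples whose left column is the first argument. `head c`, the entry above b, is `nothing`
-- exactly when b tops its column, so degenerate triples need no separate clause.
quinv₂ : Column → Column → ℕ
quinv₂ (b ∷ c) (x ∷ d) = quinv₃ (head c) b x + quinv₂ c d
quinv₂ _       _       = 0

quinvᶜ : List Column → ℕ
quinvᶜ []       = 0
quinvᶜ (c ∷ cs) = sum (map (quinv₂ c) cs) + quinvᶜ cs

-- The possible descent is the cell above b, the lowest one of c, for which leg + 1 is `length c`.
maj₁ : Column → ℕ
maj₁ []      = 0
maj₁ (b ∷ c) = length c * J (head c) b + maj₁ c

majᶜ : List Column → ℕ
majᶜ cs = sum (map maj₁ cs)

total : (Letter → ℕ) → Column → ℕ
total f c = sum (map f c)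

totalᶜ : (Letter → ℕ) → List Column → ℕ
totalᶜ f cs = sum (map (total f) cs)

-- `Rows P n c`: the entries x of c satisfy P at their rows, the lowest row being n.
Rows : (ℕ → Letter → Set) → ℕ → Column → Set
Rows P n []      = ⊤
Rows P n (x ∷ c) = P n x × Rows P (suc n) c

-- Exchanging two adjacent columns of equal height from the top down

-- `Full c d` says that an exchange started at the top runs down to the bottom: in every row,
-- exchanging the entries above would change the triple on b₁ and b₂, so these must be exchanged
-- too. In `Part` the exchange comes to a `stop` above a row whose triple is insensitive to it, and
-- the rows below are kept.
data Full : Column → Column → Set where
  top  : ∀ {b₁ b₂} → Full [ b₁ ] [ b₂ ]
  down : ∀ {a₁ a₂ b₁ b₂ c d} → quinv₃ (just a₁) b₁ b₂ ≢ quinv₃ (just a₂) b₁ b₂ →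
    Full (a₁ ∷ c) (a₂ ∷ d) → Full (b₁ ∷ a₁ ∷ c) (b₂ ∷ a₂ ∷ d)

data Part : Column → Column → Column → Column → Set where
  stop : ∀ {a₁ a₂ b₁ b₂ c d} → quinv₃ (just a₁) b₁ b₂ ≡ quinv₃ (just a₂) b₁ b₂ →
    Full (a₁ ∷ c) (a₂ ∷ d) →
    Part (b₁ ∷ a₁ ∷ c) (b₂ ∷ a₂ ∷ d) (b₁ ∷ a₂ ∷ d) (b₂ ∷ a₁ ∷ c)
  skip : ∀ {a₁ a₂ b₁ b₂ c d c′ d′} → Part (a₁ ∷ c) (a₂ ∷ d) (a₁ ∷ c′) (a₂ ∷ d′) →
    Part (b₁ ∷ a₁ ∷ c) (b₂ ∷ a₂ ∷ d) (b₁ ∷ a₁ ∷ c′) (b₂ ∷ a₂ ∷ d′)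

data Swap (c d : Column) : Column → Column → Set where
  full : Full c d → Swap c d d c
  partial : ∀ {c′ d′} → Part c d c′ d′ → Swap c d c′ d′

-- By `quinv₃-swap` the same two values of the triple reappear, attached to the exchanged entries,
-- so a second exchange runs through the same rows.
full-sym : ∀ {c d} → Full c d → Full d c
full-sym top = top
full-sym (down {a₁} {a₂} {b₁} {b₂} ≢₁ f) = down ≢₂ (full-sym f)
  where
  ≢₂ : quinv₃ (just a₂) b₂ b₁ ≢ quinv₃ (just a₁) b₂ b₁
  ≢₂ eq = ≢₁ (trans (sym (quinv₃-swap _ _ b₁ b₂ ≢₁)) (trans eq (quinv₃-swap _ _ b₁ b₂ (≢₁ ∘ sym))))

part-sym : ∀ {c d c′ d′} → Part c d c′ d′ → Part c′ d′ c d
part-sym (stop eq f) = stop (sym eq) (full-sym f)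
part-sym (skip p)    = skip (part-sym p)

swap-sym : ∀ {c d c′ d′} → Swap c d c′ d′ → Swap c′ d′ c d
swap-sym (full f) = full (full-sym f)
swap-sym (partial p) = partial (part-sym p)

full-not-part : ∀ {c d c′ d′} → Full c d → ¬ Part c d c′ d′
full-not-part (down ≢₁ f) (stop eq _) = ≢₁ eq
full-not-part (down ≢₁ f) (skip p)    = full-not-part f p

part-functional : ∀ {c d c′ d′ c″ d″} → Part c d c′ d′ → Part c d c″ d″ → c′ ≡ c″ × d′ ≡ d″
part-functional (stop _ _) (stop _ _) = refl , refl
part-functional (stop _ f) (skip p)   = contradiction p (full-not-part f)
part-functional (skip p)   (stop _ f) = contradiction p (full-not-part f)
part-functional (skip p)   (skip q)   with refl , refl ← part-functional p q = refl , refl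

swap-functional : ∀ {c d c′ d′ c″ d″} → Swap c d c′ d′ → Swap c d c″ d″ → c′ ≡ c″ × d′ ≡ d″
swap-functional (full _) (full _) = refl , refl
swap-functional (full f) (partial p) = contradiction p (full-not-part f)
swap-functional (partial p) (full f) = contradiction p (full-not-part f)
swap-functional (partial p) (partial q) = part-functional p q

swap-exists : ∀ c d → length c ≡ length d → 0 < length c → ∃[ c′ ] ∃[ d′ ] Swap c d c′ d′
swap-exists (b₁ ∷ []) (b₂ ∷ []) _ _ = _ , _ , full top
swap-exists (b₁ ∷ a₁ ∷ c) (b₂ ∷ a₂ ∷ d) eq _
  with swap-exists (a₁ ∷ c) (a₂ ∷ d) (suc-injective eq) (s≤s z≤n)
... | _ , _ , partial p@(stop _ _) = _ , _ , partial (skip p)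
... | _ , _ , partial p@(skip _)   = _ , _ , partial (skip p)
... | _ , _ , full f with quinv₃ (just a₁) b₁ b₂ ≟ quinv₃ (just a₂) b₁ b₂
...   | yes eq′ = _ , _ , partial (stop eq′ f)
...   | no ≢′   = _ , _ , full (down ≢′ f)

module _ {a₁ a₂ : Letter₀} {b₁ b₂ : Letter} (eq : quinv₃ a₁ b₁ b₂ ≡ quinv₃ a₂ b₁ b₂) where

  -- In the linear form, `eq` says that J a b₂ - J a b₁ is the same for a₁ and a₂. So the number of
  -- descents across the row where the exchange stops is preserved; both columns having the same
  -- height, maj is preserved too.
  J-exchange : J a₂ b₁ + J a₁ b₂ ≡ J a₁ b₁ + J a₂ b₂
  J-exchange = +-cancelˡ-≡ (quinv₃ a₁ b₁ b₂ + J (just b₂) b₁) _ _ $ begin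
    (q + s) + (J a₂ b₁ + J a₁ b₂)            ≡⟨ rearrange₁ q s _ _ ⟩
    (q + J a₂ b₁) + (s + J a₁ b₂)            ≡⟨ cong (λ q → (q + J a₂ b₁) + (s + J a₁ b₂)) eq ⟩
    (quinv₃ a₂ b₁ b₂ + J a₂ b₁) + (s + J a₁ b₂)  ≡⟨ cong₂ _+_ (quinv₃-linear a₂ b₁ b₂) (sym (quinv₃-linear a₁ b₁ b₂)) ⟩
    (s + J a₂ b₂) + (q + J a₁ b₁)            ≡⟨ rearrange₂ q s _ _ ⟩
    (q + s) + (J a₁ b₁ + J a₂ b₂)            ∎
    where
    open ≡-Reasoning
    q = quinv₃ a₁ b₁ b₂
    s = J (just b₂) b₁
    rearrange₁ : ∀ q s x y → (q + s) + (x + y) ≡ (q + x) + (s + y)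
    rearrange₁ = solve-∀
    rearrange₂ : ∀ q s x y → (s + x) + (q + y) ≡ (q + s) + (y + x)
    rearrange₂ = solve-∀

  -- The terms J x b₁, J x b₂, J a₁ x and J a₂ x occur on both sides of the summed linear
  -- identities, however the upper entries are distributed; `J-exchange` accounts for the rest.
  quinv₃-exchange : ∀ x → quinv₃ a₂ b₁ x + quinv₃ a₁ b₂ x ≡ quinv₃ a₁ b₁ x + quinv₃ a₂ b₂ x
  quinv₃-exchange x = +-cancelʳ-≡ (J a₂ b₁ + J a₁ b₂) _ _ $ begin
    (quinv₃ a₂ b₁ x + quinv₃ a₁ b₂ x) + (J a₂ b₁ + J a₁ b₂)
      ≡⟨ rearrange (quinv₃ a₂ b₁ x) _ _ _ ⟩
    (quinv₃ a₂ b₁ x + J a₂ b₁) + (quinv₃ a₁ b₂ x + J a₁ b₂)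
      ≡⟨ cong₂ _+_ (quinv₃-linear a₂ b₁ x) (quinv₃-linear a₁ b₂ x) ⟩
    (J (just x) b₁ + J a₂ x) + (J (just x) b₂ + J a₁ x)
      ≡⟨ exchange (J (just x) b₁) _ _ _ ⟩
    (J (just x) b₁ + J a₁ x) + (J (just x) b₂ + J a₂ x)
      ≡⟨ cong₂ _+_ (quinv₃-linear a₁ b₁ x) (quinv₃-linear a₂ b₂ x) ⟨
    (quinv₃ a₁ b₁ x + J a₁ b₁) + (quinv₃ a₂ b₂ x + J a₂ b₂)
      ≡⟨ rearrange (quinv₃ a₁ b₁ x) _ _ _ ⟨
    (quinv₃ a₁ b₁ x + quinv₃ a₂ b₂ x) + (J a₁ b₁ + J a₂ b₂)
      ≡⟨ cong ((quinv₃ a₁ b₁ x + quinv₃ a₂ b₂ x) +_) J-exchange ⟨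
    (quinv₃ a₁ b₁ x + quinv₃ a₂ b₂ x) + (J a₂ b₁ + J a₁ b₂)  ∎
    where
    open ≡-Reasoning
    rearrange : ∀ p q x y → (p + q) + (x + y) ≡ (p + x) + (q + y)
    rearrange = solve-∀
    exchange : ∀ p q x y → (p + q) + (x + y) ≡ (p + y) + (x + q)
    exchange = solve-∀

private
  interchange-cong : ∀ x y z w {x′ y′ z′ w′} → x + z ≡ x′ + z′ → y + w ≡ y′ + w′ →
    (x + y) + (z + w) ≡ (x′ + y′) + (z′ + w′)
  interchange-cong x y z w {x′} {y′} {z′} {w′} p q =
    trans (interchange x y z w) (trans (cong₂ _+_ p q) (interchange x′ z′ y′ w′))

-- A triple contains a single entry of its right column, so exchanging entries within rows merely
-- permutes the summands.
swap-quinv₂ˡ : ∀ {c d c′ d′} → Swap c d c′ d′ → ∀ e → quinv₂ e c′ + quinv₂ e d′ ≡ quinv₂ e c + quinv₂ e d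
swap-quinv₂ˡ {c} {d} (full _) e = +-comm (quinv₂ e d) (quinv₂ e c)
swap-quinv₂ˡ (partial _) [] = refl
swap-quinv₂ˡ (partial (stop {a₁} {a₂} {b₁} {b₂} {c} {d} _ f)) (b ∷ e) =
  interchange-cong (quinv₃ (head e) b b₁) (quinv₂ e (a₂ ∷ d)) (quinv₃ (head e) b b₂) _ {quinv₃ (head e) b b₁} refl
    (swap-quinv₂ˡ (full f) e)
swap-quinv₂ˡ (partial (skip {b₁ = b₁} {b₂} {c′ = c′} p)) (b ∷ e) =
  interchange-cong (quinv₃ (head e) b b₁) (quinv₂ e _) (quinv₃ (head e) b b₂) _ {quinv₃ (head e) b b₁} refl
    (swap-quinv₂ˡ (partial p) e)

-- A triple contains two adjacent entries of its left column. These are torn apart only in the row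
-- where the exchange stops, and there `quinv₃-exchange` applies.
swap-quinv₂ʳ : ∀ {c d c′ d′} → Swap c d c′ d′ → ∀ e → quinv₂ c′ e + quinv₂ d′ e ≡ quinv₂ c e + quinv₂ d e
swap-quinv₂ʳ {c} {d} (full _) e = +-comm (quinv₂ d e) (quinv₂ c e)
swap-quinv₂ʳ (partial (stop _ _)) [] = refl
swap-quinv₂ʳ (partial (skip _))   [] = refl
swap-quinv₂ʳ (partial (stop {a₁} {a₂} {b₁} {b₂} {c} {d} eq f)) (x ∷ e) =
  interchange-cong (quinv₃ (just a₂) b₁ x) (quinv₂ (a₂ ∷ d) e) (quinv₃ (just a₁) b₂ x) _ {quinv₃ (just a₁) b₁ x}
    (quinv₃-exchange eq x) (swap-quinv₂ʳ (full f) e)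
swap-quinv₂ʳ (partial (skip {a₁} {a₂} {b₁} {b₂} {c′ = c′} p)) (x ∷ e) =
  interchange-cong (quinv₃ (just a₁) b₁ x) (quinv₂ (a₁ ∷ c′) e) (quinv₃ (just a₂) b₂ x) _ {quinv₃ (just a₁) b₁ x} refl
    (swap-quinv₂ʳ (partial p) e)

quinv₃-nothing : ∀ b c → quinv₃ nothing b c ≡ J (just c) b
quinv₃-nothing b c = +-cancelʳ-≡ (J nothing b) _ _
  (trans (quinv₃-linear nothing b c) (cong (J (just c) b +_) (trans (J-nothing c) (sym (J-nothing b)))))

-- The degenerate triple on top turns from `J (just y) x` into `J (just x) y`. All other triples
-- keep their values: in exchanged rows by `quinv₃-swap`, in the row just below by the stopping
-- condition.
swap-quinv₂ : ∀ {c d c′ d′ x y} → Swap c d c′ d′ → last c ≡ just x → last d ≡ just y →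
  quinv₂ c′ d′ + J (just y) x ≡ quinv₂ c d + J (just x) y
swap-quinv₂ (full (top {x} {y})) refl refl = begin
  quinv₃ nothing y x + 0 + J (just y) x  ≡⟨ cong (λ j → j + 0 + J (just y) x) (quinv₃-nothing y x) ⟩
  J (just x) y + 0 + J (just y) x        ≡⟨ rearrange (J (just x) y) (J (just y) x) ⟩
  J (just y) x + 0 + J (just x) y        ≡⟨ cong (λ j → j + 0 + J (just x) y) (quinv₃-nothing x y) ⟨
  quinv₃ nothing x y + 0 + J (just x) y  ∎
  where
  open ≡-Reasoning
  rearrange : ∀ x y → x + 0 + y ≡ y + 0 + x
  rearrange = solve-∀
swap-quinv₂ (full (down {a₁} {a₂} {b₁} {b₂} ≢₁ f)) eq₁ eq₂ = trans (+-assoc (quinv₃ (just a₂) b₂ b₁) _ _)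
  (trans (cong₂ _+_ (quinv₃-swap _ _ b₁ b₂ ≢₁) (swap-quinv₂ (full f) eq₁ eq₂)) (sym (+-assoc (quinv₃ (just a₁) b₁ b₂) _ _)))
swap-quinv₂ (partial (stop {a₁} {a₂} {b₁} {b₂} eq f)) eq₁ eq₂ = trans (+-assoc (quinv₃ (just a₂) b₁ b₂) _ _)
  (trans (cong₂ _+_ (sym eq) (swap-quinv₂ (full f) eq₁ eq₂)) (sym (+-assoc (quinv₃ (just a₁) b₁ b₂) _ _)))
swap-quinv₂ (partial (skip {a₁} {b₁ = b₁} {b₂} p)) eq₁ eq₂ = trans (+-assoc (quinv₃ (just a₁) b₁ b₂) _ _)
  (trans (cong (quinv₃ (just a₁) b₁ b₂ +_) (swap-quinv₂ (partial p) eq₁ eq₂)) (sym (+-assoc (quinv₃ (just a₁) b₁ b₂) _ _)))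

full-length : ∀ {c d} → Full c d → length c ≡ length d
full-length top        = refl
full-length (down _ f) = cong suc (full-length f)

swap-length : ∀ {c d c′ d′} → Swap c d c′ d′ → length c′ ≡ length c × length d′ ≡ length d
swap-length (full f)           = sym (full-length f) , full-length f
swap-length (partial (stop _ f))  = cong suc (sym (full-length f)) , cong suc (full-length f)
swap-length (partial (skip p))    = let eq₁ , eq₂ = swap-length (partial p) in cong suc eq₁ , cong suc eq₂

swap-last : ∀ {c d c′ d′} → Swap c d c′ d′ → last c′ ≡ last d × last d′ ≡ last c
swap-last (full f)          = refl , refl
swap-last (partial (stop _ f)) = refl , refl
swap-last (partial (skip p))   = swap-last (partial p)

swap-maj : ∀ {c d c′ d′} → Swap c d c′ d′ → maj₁ c′ + maj₁ d′ ≡ maj₁ c + maj₁ d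
swap-maj {c} {d} (full _) = +-comm (maj₁ d) (maj₁ c)
swap-maj (partial (stop {a₁} {a₂} {b₁} {b₂} {c} {d} eq f)) =
  interchange-cong (suc (length d) * J (just a₂) b₁) _ (suc (length c) * J (just a₁) b₂) _ {suc (length c) * J (just a₁) b₁}
    heads (swap-maj (full f))
  where
  open ≡-Reasoning
  heads : suc (length d) * J (just a₂) b₁ + suc (length c) * J (just a₁) b₂
        ≡ suc (length c) * J (just a₁) b₁ + suc (length d) * J (just a₂) b₂
  heads = begin
    suc (length d) * J (just a₂) b₁ + suc (length c) * J (just a₁) b₂
      ≡⟨ cong (λ l → l * J (just a₂) b₁ + suc (length c) * J (just a₁) b₂) (full-length f) ⟨
    suc (length c) * J (just a₂) b₁ + suc (length c) * J (just a₁) b₂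
      ≡⟨ *-distribˡ-+ (suc (length c)) (J (just a₂) b₁) _ ⟨
    suc (length c) * (J (just a₂) b₁ + J (just a₁) b₂)
      ≡⟨ cong (suc (length c) *_) (J-exchange eq) ⟩
    suc (length c) * (J (just a₁) b₁ + J (just a₂) b₂)
      ≡⟨ *-distribˡ-+ (suc (length c)) (J (just a₁) b₁) _ ⟩
    suc (length c) * J (just a₁) b₁ + suc (length c) * J (just a₂) b₂
      ≡⟨ cong (λ l → suc (length c) * J (just a₁) b₁ + l * J (just a₂) b₂) (full-length f) ⟩
    suc (length c) * J (just a₁) b₁ + suc (length d) * J (just a₂) b₂  ∎
swap-maj (partial (skip {a₁} {a₂} {b₁} {b₂} {c} {d} {c′} {d′} p)) =
  interchange-cong (suc (length c′) * J (just a₁) b₁) _ (suc (length d′) * J (just a₂) b₂) _ {suc (length c) * J (just a₁) b₁}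
    (let eq₁ , eq₂ = swap-length (partial p) in
     cong₂ (λ l l′ → l * J (just a₁) b₁ + l′ * J (just a₂) b₂) eq₁ eq₂)
    (swap-maj (partial p))

swap-total : ∀ f {c d c′ d′} → Swap c d c′ d′ → total f c′ + total f d′ ≡ total f c + total f d
swap-total f {c} {d} (full _) = +-comm (total f d) (total f c)
swap-total f (partial (stop {a₁} {a₂} {b₁} {b₂} {c} {d} _ fl)) =
  interchange-cong (f b₁) (total f (a₂ ∷ d)) (f b₂) _ {f b₁} refl (swap-total f (full fl))
swap-total f (partial (skip {a₁} {b₁ = b₁} {b₂} {c′ = c′} p)) =
  interchange-cong (f b₁) (total f (a₁ ∷ c′)) (f b₂) _ {f b₁} refl (swap-total f (partial p))

swap-rows : ∀ {P n c d c′ d′} → Swap c d c′ d′ → Rows P n c → Rows P n d → Rows P n c′ × Rows P n d′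
swap-rows (full _)          rc       rd       = rd , rc
swap-rows (partial (stop _ _)) (b , rc) (b′ , rd) = (b , rd) , (b′ , rc)
swap-rows (partial (skip p))   (b , rc) (b′ , rd) =
  let rc′ , rd′ = swap-rows (partial p) rc rd in (b , rc′) , (b′ , rd′)

swap-quinvᶜ : ∀ {c d c′ d′ x y} → Swap c d c′ d′ → last c ≡ just x → last d ≡ just y → ∀ Z →
  quinvᶜ (c′ ∷ d′ ∷ Z) + J (just y) x ≡ quinvᶜ (c ∷ d ∷ Z) + J (just x) y
swap-quinvᶜ {c} {d} {c′} {d′} {x} {y} s eq₁ eq₂ Z = begin
  ((quinv₂ c′ d′ + Σ c′) + (Σ d′ + quinvᶜ Z)) + J (just y) x
    ≡⟨ rearrange (quinv₂ c′ d′) _ _ _ _ ⟩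
  (quinv₂ c′ d′ + J (just y) x) + (Σ c′ + Σ d′) + quinvᶜ Z
    ≡⟨ cong₂ (λ p q → p + q + quinvᶜ Z) (swap-quinv₂ s eq₁ eq₂) (sums Z) ⟩
  (quinv₂ c d + J (just x) y) + (Σ c + Σ d) + quinvᶜ Z
    ≡⟨ rearrange (quinv₂ c d) _ _ _ _ ⟨
  ((quinv₂ c d + Σ c) + (Σ d + quinvᶜ Z)) + J (just x) y  ∎
  where
  open ≡-Reasoning
  Σ : Column → ℕ
  Σ e = sum (map (quinv₂ e) Z)
  rearrange : ∀ q s t z j → ((q + s) + (t + z)) + j ≡ (q + j) + (s + t) + z
  rearrange = solve-∀
  sums : ∀ Z → sum (map (quinv₂ c′) Z) + sum (map (quinv₂ d′) Z) ≡ sum (map (quinv₂ c) Z) + sum (map (quinv₂ d) Z)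
  sums []      = refl
  sums (e ∷ Z) = trans (interchange (quinv₂ c′ e) _ _ _)
    (trans (cong₂ _+_ (swap-quinv₂ʳ s e) (sums Z)) (sym (interchange (quinv₂ c e) _ _ _)))

-- W arises from c ∷ X by moving the top entry of c to the right, past k columns.
data Slide : ℕ → Column → List Column → List Column → Set where
  stay : ∀ {c X} → Slide 0 c X (c ∷ X)
  move : ∀ {k c x x′ c′ X W} → Swap c x x′ c′ → Slide k c′ X W → Slide (suc k) c (x ∷ X) (x′ ∷ W)

slide-functional : ∀ {k c X W W′} → Slide k c X W → Slide k c X W′ → W ≡ W′
slide-functional stay       stay         = refl
slide-functional (move s w) (move s′ w′) with refl , refl ← swap-functional s s′ =
  cong (_ ∷_) (slide-functional w w′)

slide-injective : ∀ {k c X c′ X′ W} → Slide k c X W → Slide k c′ X′ W → c ≡ c′ × X ≡ X′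
slide-injective stay       stay         = refl , refl
slide-injective (move s w) (move s′ w′) with refl , refl ← slide-injective w w′
  with refl , refl ← swap-functional (swap-sym s) (swap-sym s′) = refl , refl

slide-≤ : ∀ {k c X W} → Slide k c X W → k ≤ length X
slide-≤ stay       = z≤n
slide-≤ (move _ w) = s≤s (slide-≤ w)

slide-length : ∀ {k c X W} → Slide k c X W → map length W ≡ map length (c ∷ X)
slide-length stay       = refl
slide-length (move s w) = let eq₁ , eq₂ = swap-length s in
  cong₂ _∷_ eq₁ (trans (slide-length w) (cong (_∷ _) eq₂))

all-length : ∀ {P : ℕ → Set} (xs ys : List Column) → map length xs ≡ map length ys →
  All (P ∘ length) xs → All (P ∘ length) ys
all-length []       []       _  []        = []
all-length {P} (x ∷ xs) (y ∷ ys) eq (px ∷ pxs) =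
  subst P (∷-injectiveˡ eq) px ∷ all-length {P} xs ys (∷-injectiveʳ eq) pxs

slide-exists : ∀ {r} → 0 < r → ∀ k c X → length c ≡ r → All (λ x → length x ≡ r) X → k ≤ length X →
  ∃[ W ] Slide k c X W
slide-exists r>0 zero    c X       _  _          _    = _ , stay
slide-exists r>0 (suc k) c (x ∷ X) ∣c∣ (∣x∣ ∷ ∣X∣) k≤ =
  let _ , c′ , s = swap-exists c x (trans ∣c∣ (sym ∣x∣)) (subst (0 <_) (sym ∣c∣) r>0)
      _ , w = slide-exists r>0 k c′ X (trans (proj₂ (swap-length s)) ∣x∣) ∣X∣ (s≤s⁻¹ k≤)
  in _ , move s w

unslide-exists : ∀ {r} → 0 < r → ∀ Q z S → All (λ x → length x ≡ r) (Q ++ z ∷ S) →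
  ∃[ c ] ∃[ X ] Slide (length Q) c X (Q ++ z ∷ S)
unslide-exists r>0 []      z S _ = z , S , stay
unslide-exists {r} r>0 (q ∷ Q) z S (∣q∣ ∷ all) with unslide-exists r>0 Q z S all
... | c , X , w =
  let ∣c∣ = All.head (all-length {_≡ r} (Q ++ z ∷ S) (c ∷ X) (slide-length w) all)
      c₀ , x , s = swap-exists q c (trans ∣q∣ (sym ∣c∣)) (subst (0 <_) (sym ∣q∣) r>0)
  in c₀ , x ∷ X , move (swap-sym s) w

slide-sum : ∀ (f : Column → ℕ) → (∀ {c d c′ d′} → Swap c d c′ d′ → f c′ + f d′ ≡ f c + f d) →
  ∀ {k c X W} → Slide k c X W → ∀ Z → sum (map f (W ++ Z)) ≡ sum (map f (c ∷ X ++ Z))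
slide-sum f inv stay Z = refl
slide-sum f inv (move {c = c} {x} {x′} {c′} {X} {W} s w) Z = begin
  f x′ + sum (map f (W ++ Z))             ≡⟨ cong (f x′ +_) (slide-sum f inv w Z) ⟩
  f x′ + (f c′ + sum (map f (X ++ Z)))    ≡⟨ +-assoc (f x′) _ _ ⟨
  (f x′ + f c′) + sum (map f (X ++ Z))    ≡⟨ cong (_+ sum (map f (X ++ Z))) (inv s) ⟩
  (f c + f x) + sum (map f (X ++ Z))      ≡⟨ +-assoc (f c) _ _ ⟩
  f c + (f x + sum (map f (X ++ Z)))      ∎
  where open ≡-Reasoning

slide-rows : ∀ {P n k c X W} → Slide k c X W → All (Rows P n) (c ∷ X) → All (Rows P n) W
slide-rows stay       rs              = rs
slide-rows (move s w) (rc ∷ rx ∷ rs) = let rx′ , rc′ = swap-rows s rc rx in rx′ ∷ slide-rows w (rc′ ∷ rs)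

unslide-rows : ∀ {P n k c X W} → Slide k c X W → All (Rows P n) W → All (Rows P n) (c ∷ X)
unslide-rows stay       rs         = rs
unslide-rows (move s w) (rx′ ∷ rs) with unslide-rows w rs
... | rc′ ∷ rX = let rc , rx = swap-rows (swap-sym s) rx′ rc′ in rc ∷ rx ∷ rX

-- Differences are recorded by summands on both sides, which avoids subtraction in ℕ. The case δ = 0
-- serves columns that do not notice a change on their right, δ = 1 the block columns left of a
-- flip.
quinvᶜ-prefix : ∀ As {Ys Ys′ δ m m′} →
  All (λ e → sum (map (quinv₂ e) Ys′) ≡ δ + sum (map (quinv₂ e) Ys)) As →
  quinvᶜ Ys′ + m ≡ quinvᶜ Ys + m′ → quinvᶜ (As ++ Ys′) + m ≡ quinvᶜ (As ++ Ys) + (length As * δ + m′)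
quinvᶜ-prefix []       _          eq = eq
quinvᶜ-prefix (e ∷ As) {Ys} {Ys′} {δ} {m} {m′} (h ∷ hs) eq = begin
  (Σ (As ++ Ys′) + quinvᶜ (As ++ Ys′)) + m
    ≡⟨ +-assoc (Σ (As ++ Ys′)) _ _ ⟩
  Σ (As ++ Ys′) + (quinvᶜ (As ++ Ys′) + m)
    ≡⟨ cong₂ _+_ (Σ-++ Ys′) (quinvᶜ-prefix As hs eq) ⟩
  (Σ As + Σ Ys′) + (quinvᶜ (As ++ Ys) + (length As * δ + m′))
    ≡⟨ cong (λ s → (Σ As + s) + (quinvᶜ (As ++ Ys) + (length As * δ + m′))) h ⟩
  (Σ As + (δ + Σ Ys)) + (quinvᶜ (As ++ Ys) + (length As * δ + m′))
    ≡⟨ rearrange (Σ As) _ _ _ _ _ ⟩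
  ((Σ As + Σ Ys) + quinvᶜ (As ++ Ys)) + (δ + length As * δ + m′)
    ≡⟨ cong (λ s → (s + quinvᶜ (As ++ Ys)) + (δ + length As * δ + m′)) (Σ-++ Ys) ⟨
  (Σ (As ++ Ys) + quinvᶜ (As ++ Ys)) + (δ + length As * δ + m′)  ∎
  where
  open ≡-Reasoning
  Σ : List Column → ℕ
  Σ Z = sum (map (quinv₂ e) Z)
  Σ-++ : ∀ Z → Σ (As ++ Z) ≡ Σ As + Σ Z
  Σ-++ Z = trans (cong sum (map-++ (quinv₂ e) As Z)) (sum-++ (map (quinv₂ e) As) _)
  rearrange : ∀ s d t q l m → (s + (d + t)) + (q + (l + m)) ≡ ((s + t) + q) + (d + l + m)
  rearrange = solve-∀

-- As in `Letter`, n stands for the label n + 1; r is the (1-based) row of the distinguished cell.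
module Distinguished (n r : ℕ) (n<r : suc n < r) where

  -- The first condition excludes label candidates below n + 1, the second excludes the label n + 1
  -- above row r. Only rows and absolute values enter, so exchanges and flips preserve both.
  Admissible : ℕ → Letter → Set
  Admissible ρ x = (∣ x ∣ < suc n → ρ ≤ ∣ x ∣) × (∣ x ∣ ≡ suc n → ρ ≤ r)

  Admissibleᶜ : Column → Set
  Admissibleᶜ = Rows Admissible 1

  admissible-≥ : ∀ {ρ x} → Admissible ρ x → suc n ≤ ρ → suc n ≤ ∣ x ∣
  admissible-≥ {ρ} {x} (h , _) n≤ρ with suc n ≤? ∣ x ∣
  ... | yes le = le
  ... | no ≰   = ≤-trans n≤ρ (h (≰⇒> ≰))

  admissible-> : ∀ {ρ x} → Admissible ρ x → r < ρ → suc n < ∣ x ∣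
  admissible-> {ρ} {x} ad r<ρ = ≤∧≢⇒< (admissible-≥ ad (<⇒≤ (<-trans n<r r<ρ)))
    (λ eq → <⇒≱ r<ρ (proj₂ ad (sym eq)))

  Marked : Column → Set
  Marked c = Maybe.map ∣_∣ (last c) ≡ just (suc n)

  marked? : ∀ c → Dec (Marked c)
  marked? c = Maybe.≡-dec _≟_ _ _

  open Marks marked? public

  Big : Column → Set
  Big c = ∃[ y ] last c ≡ just y × suc n < ∣ y ∣

  rows-last : ∀ {P m c} → Rows P m c → 0 < length c → ∃[ y ] ∃[ ρ ] last c ≡ just y × P ρ y × suc ρ ≡ m + length c
  rows-last {m = m} {x ∷ []}    (p , _)  _ = x , m , refl , p , sym (+-comm m 1)
  rows-last {m = m} {_ ∷ x ∷ c} (_ , ps) _ =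
    let y , ρ , eq , p , eq′ = rows-last ps (s≤s z≤n) in y , ρ , eq , p , trans eq′ (sym (+-suc m _))

  top-entry : ∀ {c} → length c ≡ r → Admissibleᶜ c → ∃[ y ] last c ≡ just y × suc n ≤ ∣ y ∣
  top-entry {c} ∣c∣ ad =
    let y , ρ , eq , p , eq′ = rows-last ad (subst (0 <_) (sym ∣c∣) (≤-trans (s≤s z≤n) n<r)) in
    y , eq , admissible-≥ p (subst (suc n ≤_) (suc-injective (sym (trans eq′ (cong suc ∣c∣)))) (<⇒≤ n<r))

  plain⇒big : ∀ {c} → length c ≡ r → Admissibleᶜ c → ¬ Marked c → Big c
  plain⇒big ∣c∣ ad ¬marked = let y , eq , n≤y = top-entry ∣c∣ ad in
    y , eq , ≤∧≢⇒< n≤y (λ n≡y → ¬marked (trans (cong (Maybe.map ∣_∣) eq) (cong just (sym n≡y))))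

  -- Each exchange interchanges the two top entries, so the mark travels with the slide while the
  -- plain tops that it passes shift one place to the left.
  slide-shape : ∀ {k c X W} → Slide k c X W → Marked c → Plain X →
    ∃[ Q ] ∃[ z ] ∃[ S ] W ≡ Q ++ z ∷ S × length Q ≡ k × length Q + length S ≡ length X
      × Plain Q × Plain S × Marked z × last z ≡ last c
  slide-shape (stay {c} {X}) mc pl = [] , c , X , refl , refl , refl , [] , pl , mc , refl
  slide-shape (move {x′ = x′} s w) mc (¬x ∷ pl) =
    let eq₁ , eq₂ = swap-last s
        Q , z , S , eq , ∣Q∣ , ∣X∣ , plQ , plS , mz , last≡ =
          slide-shape w (trans (cong (Maybe.map ∣_∣) eq₂) mc) pl
    in x′ ∷ Q , z , S , cong (x′ ∷_) eq , cong suc ∣Q∣ , cong suc ∣X∣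
     , (λ mx′ → ¬x (trans (cong (Maybe.map ∣_∣) (sym eq₁)) mx′)) ∷ plQ , plS , mz , trans last≡ eq₂

  unslide-shape : ∀ Q {c z S X} → Slide (length Q) c X (Q ++ z ∷ S) → Plain Q → Plain S →
    Plain X × last c ≡ last z
  unslide-shape []      stay       _          plS = plS , refl
  unslide-shape (q ∷ Q) (move s w) (¬q ∷ plQ) plS =
    let eq₁ , eq₂ = swap-last s
        plX , last≡ = unslide-shape Q w plQ plS
    in (λ mx → ¬q (trans (cong (Maybe.map ∣_∣) eq₁) mx)) ∷ plX , trans (sym eq₂) last≡

  slide-quinv⁺ : ∀ {k c X W} → Slide k c X W → last c ≡ just (pos n) → All Big X → ∀ Z →
    quinvᶜ (W ++ Z) + k ≡ quinvᶜ (c ∷ X ++ Z)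
  slide-quinv⁺ stay _ _ Z = +-identityʳ _
  slide-quinv⁺ (move {k} {c} {x} {x′} {c′} {X} {W} s w) eq ((y , eqʸ , n<y) ∷ big) Z = begin
    (sum (map (quinv₂ x′) (W ++ Z)) + quinvᶜ (W ++ Z)) + suc k
      ≡⟨ rearrange (sum (map (quinv₂ x′) (W ++ Z))) _ k ⟩
    (sum (map (quinv₂ x′) (W ++ Z)) + (quinvᶜ (W ++ Z) + k)) + 1
      ≡⟨ cong₂ (λ p q → p + q + 1) (slide-sum (quinv₂ x′) (λ s → swap-quinv₂ˡ s x′) w Z)
               (slide-quinv⁺ w (trans (proj₂ (swap-last s)) eq) big Z) ⟩
    quinvᶜ (x′ ∷ c′ ∷ X ++ Z) + 1
      ≡⟨ cong (quinvᶜ (x′ ∷ c′ ∷ X ++ Z) +_) (J-above-least n<y) ⟨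
    quinvᶜ (x′ ∷ c′ ∷ X ++ Z) + J (just y) (pos n)
      ≡⟨ swap-quinvᶜ s eq eqʸ (X ++ Z) ⟩
    quinvᶜ (c ∷ x ∷ X ++ Z) + J (just (pos n)) y
      ≡⟨ cong (quinvᶜ (c ∷ x ∷ X ++ Z) +_) (J-least (<⇒≤ n<y)) ⟩
    quinvᶜ (c ∷ x ∷ X ++ Z) + 0
      ≡⟨ +-identityʳ _ ⟩
    quinvᶜ (c ∷ x ∷ X ++ Z)  ∎
    where
    open ≡-Reasoning
    rearrange : ∀ s q k → (s + q) + suc k ≡ (s + (q + k)) + 1
    rearrange = solve-∀

  slide-quinv⁻ : ∀ {k c X W} → Slide k c X W → last c ≡ just (neg n) → All Big X → ∀ Z →
    quinvᶜ (W ++ Z) ≡ quinvᶜ (c ∷ X ++ Z) + k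
  slide-quinv⁻ stay _ _ Z = sym (+-identityʳ _)
  slide-quinv⁻ (move {k} {c} {x} {x′} {c′} {X} {W} s w) eq ((y , eqʸ , n<y) ∷ big) Z = begin
    sum (map (quinv₂ x′) (W ++ Z)) + quinvᶜ (W ++ Z)
      ≡⟨ cong₂ _+_ (slide-sum (quinv₂ x′) (λ s → swap-quinv₂ˡ s x′) w Z)
               (slide-quinv⁻ w (trans (proj₂ (swap-last s)) eq) big Z) ⟩
    sum (map (quinv₂ x′) (c′ ∷ X ++ Z)) + (quinvᶜ (c′ ∷ X ++ Z) + k)
      ≡⟨ +-assoc (sum (map (quinv₂ x′) (c′ ∷ X ++ Z))) _ k ⟨
    quinvᶜ (x′ ∷ c′ ∷ X ++ Z) + k
      ≡⟨ cong (_+ k) (+-identityʳ (quinvᶜ (x′ ∷ c′ ∷ X ++ Z))) ⟨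
    quinvᶜ (x′ ∷ c′ ∷ X ++ Z) + 0 + k
      ≡⟨ cong (λ j → quinvᶜ (x′ ∷ c′ ∷ X ++ Z) + j + k) (J-below-greatest n<y) ⟨
    quinvᶜ (x′ ∷ c′ ∷ X ++ Z) + J (just y) (neg n) + k
      ≡⟨ cong (_+ k) (swap-quinvᶜ s eq eqʸ (X ++ Z)) ⟩
    quinvᶜ (c ∷ x ∷ X ++ Z) + J (just (neg n)) y + k
      ≡⟨ cong (λ j → quinvᶜ (c ∷ x ∷ X ++ Z) + j + k) (J-greatest (<⇒≤ n<y)) ⟩
    quinvᶜ (c ∷ x ∷ X ++ Z) + 1 + k
      ≡⟨ +-assoc (quinvᶜ (c ∷ x ∷ X ++ Z)) 1 k ⟩
    quinvᶜ (c ∷ x ∷ X ++ Z) + suc k  ∎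
    where open ≡-Reasoning

  -- Flipping the sign of the top entry of a column

  data Flip : Column → Column → Set where
    top : Flip [ pos n ] [ neg n ]
    _∷_ : ∀ x {y z c d} → Flip (y ∷ c) (z ∷ d) → Flip (x ∷ y ∷ c) (x ∷ z ∷ d)

  flip-functional : ∀ {c d d′} → Flip c d → Flip c d′ → d ≡ d′
  flip-functional top     top      = refl
  flip-functional (x ∷ f) (_ ∷ f′) = cong (x ∷_) (flip-functional f f′)

  flip-injective : ∀ {c c′ d} → Flip c d → Flip c′ d → c ≡ c′
  flip-injective top     top      = refl
  flip-injective (x ∷ f) (_ ∷ f′) = cong (x ∷_) (flip-injective f f′)

  flip-last : ∀ {c d} → Flip c d → last c ≡ just (pos n) × last d ≡ just (neg n)
  flip-last top     = refl , refl
  flip-last (x ∷ f) = flip-last f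

  flip-exists : ∀ {c} → last c ≡ just (pos n) → ∃[ d ] Flip c d
  flip-exists {_ ∷ []}    refl = _ , top
  flip-exists {x ∷ y ∷ c} eq with flip-exists {y ∷ c} eq
  ... | _ , f@top     = _ , x ∷ f
  ... | _ , f@(_ ∷ _) = _ , x ∷ f

  unflip-exists : ∀ {d} → last d ≡ just (neg n) → ∃[ c ] Flip c d
  unflip-exists {_ ∷ []}    refl = _ , top
  unflip-exists {x ∷ y ∷ c} eq with unflip-exists {y ∷ c} eq
  ... | _ , f@top     = _ , x ∷ f
  ... | _ , f@(_ ∷ _) = _ , x ∷ f

  flip-length : ∀ {c d} → Flip c d → length d ≡ length c
  flip-length top     = refl
  flip-length (_ ∷ f) = cong suc (flip-length f)

  flip-rows : ∀ {P : ℕ → Letter → Set} → (∀ {ρ} → P ρ (pos n) → P ρ (neg n)) →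
    ∀ {c d m} → Flip c d → Rows P m c → Rows P m d
  flip-rows h top     (p , rs) = h p , rs
  flip-rows h (_ ∷ f) (p , rs) = p , flip-rows h f rs

  unflip-rows : ∀ {P : ℕ → Letter → Set} → (∀ {ρ} → P ρ (neg n) → P ρ (pos n)) →
    ∀ {c d m} → Flip c d → Rows P m d → Rows P m c
  unflip-rows h top     (p , rs) = h p , rs
  unflip-rows h (_ ∷ f) (p , rs) = p , unflip-rows h f rs

  flip-total : ∀ f {c d} → Flip c d → total f d + f (pos n) ≡ total f c + f (neg n)
  flip-total f top      = rearrange (f (neg n)) (f (pos n))
    where
    rearrange : ∀ x y → x + 0 + y ≡ y + 0 + x
    rearrange = solve-∀
  flip-total f (x ∷ fl) = trans (+-assoc (f x) _ _)
    (trans (cong (f x +_) (flip-total f fl)) (sym (+-assoc (f x) _ _)))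

  -- An extreme letter on top compares alike with both entries below it, so J a b and J a c cancel
  -- in the linear form, for either sign.
  quinv₃-extreme : ∀ {b x} → suc n ≤ ∣ b ∣ → suc n ≤ ∣ x ∣ →
    quinv₃ (just (neg n)) b x ≡ quinv₃ (just (pos n)) b x
  quinv₃-extreme {b} {x} n≤b n≤x = trans
    (+-cancelʳ-≡ 1 _ _ (subst₂ (λ i j → quinv₃ (just (neg n)) b x + i ≡ J (just x) b + j)
      (J-greatest n≤b) (J-greatest n≤x) (quinv₃-linear (just (neg n)) b x)))
    (sym (+-cancelʳ-≡ 0 _ _ (subst₂ (λ i j → quinv₃ (just (pos n)) b x + i ≡ J (just x) b + j)
      (J-least n≤b) (J-least n≤x) (quinv₃-linear (just (pos n)) b x))))

  -- From `pos n` to `neg n` the term J c b rises from 0 to 1 while J a c falls from 1 to 0; the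
  -- latter uses that a is strictly larger in absolute value.
  quinv₃-extremeʳ : ∀ {a b} → suc n < ∣ a ∣ → suc n ≤ ∣ b ∣ →
    quinv₃ (just a) b (neg n) ≡ quinv₃ (just a) b (pos n)
  quinv₃-extremeʳ {a} {b} n<a n≤b = +-cancelʳ-≡ (J (just a) b) _ _ $ begin
    quinv₃ (just a) b (neg n) + J (just a) b     ≡⟨ quinv₃-linear (just a) b (neg n) ⟩
    J (just (neg n)) b + J (just a) (neg n)      ≡⟨ cong₂ _+_ (J-greatest n≤b) (J-below-greatest n<a) ⟩
    1                                            ≡⟨ cong₂ _+_ (J-least n≤b) (J-above-least n<a) ⟨
    J (just (pos n)) b + J (just a) (pos n)      ≡⟨ quinv₃-linear (just a) b (pos n) ⟨
    quinv₃ (just a) b (pos n) + J (just a) b     ∎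
    where open ≡-Reasoning

  private
    second-row : ∀ m → m + 2 ≡ suc r → suc n ≤ m
    second-row m eq = s≤s⁻¹ (subst (suc n <_) (sym (suc-injective (trans (+-comm 2 m) eq))) n<r)

    top-row : ∀ m → m + 1 ≡ suc r → m ≡ r
    top-row m eq = suc-injective (trans (+-comm 1 m) eq)

    next-row : ∀ m l → m + suc l ≡ suc r → suc m + l ≡ suc r
    next-row m l eq = trans (sym (+-suc m l)) eq

  -- The top cell becomes a descent, with leg + 1 = 1. The equation `m + length c ≡ suc r` expresses
  -- that c, starting in row m, ends in row r; the entry below the top then lies in row r - 1, where
  -- the flipped letters are still extreme.
  flip-maj : ∀ {c d m} → Flip c d → Rows Admissible m c → m + length c ≡ suc r → 1 < length c →
    maj₁ d ≡ suc (maj₁ c)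
  flip-maj top _ _ (s≤s ())
  flip-maj {m = m} (x ∷ top) (px , _) eq _ = trans
    (cong (λ j → j + 0 + 0) (J-greatest n≤x)) (cong (λ j → suc (j + 0 + 0)) (sym (J-least n≤x)))
    where
    n≤x : suc n ≤ ∣ x ∣
    n≤x = admissible-≥ px (second-row m eq)
  flip-maj {m = m} (_∷_ x {c = c} {d} f@(y ∷ _)) (_ , rs) eq _ = trans
    (cong₂ _+_ (cong (λ l → l * J (just y) x) (flip-length f)) (flip-maj f rs (next-row m _ eq) (s≤s (s≤s z≤n))))
    (+-suc _ _)

  -- The triple of e with the flipped entry has an entry of row r + 1 on top. Since the label n + 1
  -- does not occur above row r, `quinv₃-extremeʳ` applies.
  flip-tallerˡ : ∀ {c d m} e → Flip c d → Rows Admissible m e → m + length c ≡ suc r → length c < length e →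
    quinv₂ e d ≡ quinv₂ e c
  flip-tallerˡ (b ∷ []) top _ _ (s≤s ())
  flip-tallerˡ {m = m} (b ∷ a ∷ e) top (pb , pa , _) eq _ with refl ← top-row m eq =
    cong (_+ 0) (quinv₃-extremeʳ (admissible-> pa ≤-refl) (admissible-≥ pb (<⇒≤ n<r)))
  flip-tallerˡ {m = m} (b ∷ e) (x ∷ f) (_ , rs) eq lt =
    cong (quinv₃ (head e) b x +_) (flip-tallerˡ e f rs (next-row m _ eq) (s≤s⁻¹ lt))

  -- The flipped entry takes part in a triple with e only as the top of the one in row r - 1, if e
  -- reaches that row.
  flip-shorterʳ : ∀ {c d m} e → Flip c d → Rows Admissible m c → Rows Admissible m e → m + length c ≡ suc r →
    length e < length c → quinv₂ d e ≡ quinv₂ c e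
  flip-shorterʳ []          top     _ _ _ _ = refl
  flip-shorterʳ []          (_ ∷ _) _ _ _ _ = refl
  flip-shorterʳ (_ ∷ _)     top     _ _ _ (s≤s ())
  flip-shorterʳ (_ ∷ _ ∷ _) (_ ∷ top) _ _ _ (s≤s (s≤s ()))
  flip-shorterʳ {m = m} (y ∷ []) (x ∷ top) (px , _) (py , _) eq _ =
    cong (_+ 0) (quinv₃-extreme (admissible-≥ px (second-row m eq)) (admissible-≥ py (second-row m eq)))
  flip-shorterʳ {m = m} (y ∷ e) (x ∷ f@(z ∷ _)) (_ , rc) (_ , re) eq lt =
    cong (quinv₃ (just z) x y +_) (flip-shorterʳ e f rc re (next-row m _ eq) (s≤s⁻¹ lt))

  flip-equalˡ : ∀ {c d m} e → Flip c d → Rows Admissible m e → m + length c ≡ suc r → length e ≡ length c →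
    quinv₂ e d ≡ suc (quinv₂ e c)
  flip-equalˡ {m = m} (b ∷ []) top (pb , _) eq _ with refl ← top-row m eq = trans
    (cong (_+ 0) (trans (quinv₃-nothing b (neg n)) (J-greatest n≤b)))
    (cong (λ q → suc (q + 0)) (sym (trans (quinv₃-nothing b (pos n)) (J-least n≤b))))
    where
    n≤b : suc n ≤ ∣ b ∣
    n≤b = admissible-≥ pb (<⇒≤ n<r)
  flip-equalˡ {m = m} (b ∷ e) (x ∷ f) (_ , rs) eq ∣e∣ = trans
    (cong (quinv₃ (head e) b x +_) (flip-equalˡ e f rs (next-row m _ eq) (suc-injective ∣e∣))) (+-suc _ _)

  -- Here δ is the loss in the degenerate triple, 0 for a marked e and 1 for a plain one. The triple
  -- in row r - 1, which has the flipped entry on top, is unaffected by `quinv₃-extreme`.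
  flip-equalʳ : ∀ {c d m y δ} e → Flip c d → Rows Admissible m c → Rows Admissible m e → m + length c ≡ suc r →
    length e ≡ length c → last e ≡ just y → J (just y) (pos n) ≡ δ + J (just y) (neg n) →
    quinv₂ c e ≡ δ + quinv₂ d e
  flip-equalʳ {δ = δ} (y ∷ []) top _ _ _ _ refl h = trans
    (cong (_+ 0) (trans (quinv₃-nothing (pos n) y) h))
    (trans (+-assoc δ _ 0) (cong (λ q → δ + (q + 0)) (sym (quinv₃-nothing (neg n) y))))
  flip-equalʳ {m = m} {δ = δ} (w ∷ z ∷ []) (x ∷ top) (px , rc) (pw , re) eq ∣e∣ eqʸ h = trans
    (cong₂ _+_ (sym (quinv₃-extreme (admissible-≥ px (second-row m eq)) (admissible-≥ pw (second-row m eq))))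
               (flip-equalʳ {δ = δ} (z ∷ []) top rc re (next-row m _ eq) refl eqʸ h))
    (x∙yz≈y∙xz (quinv₃ (just (neg n)) x w) δ _)
  flip-equalʳ {m = m} {δ = δ} (w ∷ e@(_ ∷ _)) (x ∷ f@(z ∷ _)) (_ , rc) (_ , re) eq ∣e∣ eqʸ h = trans
    (cong (quinv₃ (just z) x w +_) (flip-equalʳ e f rc re (next-row m _ eq) (suc-injective ∣e∣) eqʸ h))
    (x∙yz≈y∙xz (quinv₃ (just z) x w) δ _)

  flip-sum : ∀ {c d} Z → Flip c d → length c ≡ r → Admissibleᶜ c →
    All (λ e → length e ≡ r) Z → All Admissibleᶜ Z →
    sum (map (quinv₂ d) Z) + #plain Z ≡ sum (map (quinv₂ c) Z)
  flip-sum []      f ∣c∣ ad [] [] = refl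
  flip-sum {c} {d} (e ∷ Z) f ∣c∣ adc (∣e∣ ∷ ∣Z∣) (ade ∷ adZ) with marked? e
  ... | yes me with top-entry ∣e∣ ade
  ...   | y , eqʸ , _ = begin
    (quinv₂ d e + sum (map (quinv₂ d) Z)) + #plain Z  ≡⟨ +-assoc (quinv₂ d e) _ _ ⟩
    quinv₂ d e + (sum (map (quinv₂ d) Z) + #plain Z)  ≡⟨ cong₂ _+_ (sym step) (flip-sum Z f ∣c∣ adc ∣Z∣ adZ) ⟩
    quinv₂ c e + sum (map (quinv₂ c) Z)               ∎
    where
    open ≡-Reasoning
    ∣y∣ : ∣ y ∣ ≡ suc n
    ∣y∣ = Maybe.just-injective (trans (cong (Maybe.map ∣_∣) (sym eqʸ)) me)
    step : quinv₂ c e ≡ quinv₂ d e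
    step = flip-equalʳ e f adc ade (cong suc ∣c∣) (trans ∣e∣ (sym ∣c∣)) eqʸ (sym (J-equal ∣y∣))
  flip-sum {c} {d} (e ∷ Z) f ∣c∣ adc (∣e∣ ∷ ∣Z∣) (ade ∷ adZ) | no ¬me with plain⇒big ∣e∣ ade ¬me
  ...   | y , eqʸ , n<y = begin
    (quinv₂ d e + sum (map (quinv₂ d) Z)) + suc (#plain Z)  ≡⟨ rearrange (quinv₂ d e) _ _ ⟩
    suc (quinv₂ d e) + (sum (map (quinv₂ d) Z) + #plain Z)  ≡⟨ cong₂ _+_ (sym step) (flip-sum Z f ∣c∣ adc ∣Z∣ adZ) ⟩
    quinv₂ c e + sum (map (quinv₂ c) Z)                     ∎
    where
    open ≡-Reasoning
    rearrange : ∀ x y z → (x + y) + suc z ≡ suc x + (y + z)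
    rearrange = solve-∀
    step : quinv₂ c e ≡ 1 + quinv₂ d e
    step = flip-equalʳ e f adc ade (cong suc ∣c∣) (trans ∣e∣ (sym ∣c∣)) eqʸ
      (trans (J-above-least n<y) (cong suc (sym (J-below-greatest n<y))))

  flip-quinvᶜ : ∀ {c d} L P Z R → Flip c d → length c ≡ r → Admissibleᶜ c →
    All (λ e → r < length e) L → All (λ e → length e ≡ r) P → All (λ e → length e ≡ r) Z → All (λ e → length e < r) R →
    All Admissibleᶜ L → All Admissibleᶜ P → All Admissibleᶜ Z → All Admissibleᶜ R →
    quinvᶜ (L ++ P ++ d ∷ Z ++ R) + #plain Z ≡ quinvᶜ (L ++ P ++ c ∷ Z ++ R) + length P
  flip-quinvᶜ {c} {d} L P Z R f ∣c∣ adc ∣L∣ ∣P∣ ∣Z∣ ∣R∣ adL adP adZ adR =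
    trans (quinvᶜ-prefix L {δ = 0} (All.zipWith (λ {e} (lt , ad) → left e lt ad) (∣L∣ , adL))
            (quinvᶜ-prefix P {δ = 1} (All.zipWith (λ {e} (∣e∣ , ad) → cong (_+ sum (map (quinv₂ e) (Z ++ R)))
                (flip-equalˡ e f ad (cong suc ∣c∣) (trans ∣e∣ (sym ∣c∣)))) (∣P∣ , adP)) inner))
          (cong (quinvᶜ (L ++ P ++ c ∷ Z ++ R) +_) (rearrange (length L) (length P)))
    where
    open ≡-Reasoning
    rearrange : ∀ l p → l * 0 + (p * 1 + 0) ≡ p
    rearrange = solve-∀
    rearrange′ : ∀ z r q p → ((z + r) + q) + p ≡ ((z + p) + r) + q
    rearrange′ = solve-∀
    left : ∀ e → r < length e → Admissibleᶜ e →
      sum (map (quinv₂ e) (P ++ d ∷ Z ++ R)) ≡ sum (map (quinv₂ e) (P ++ c ∷ Z ++ R))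
    left e lt ad = go P
      where
      go : ∀ P → sum (map (quinv₂ e) (P ++ d ∷ Z ++ R)) ≡ sum (map (quinv₂ e) (P ++ c ∷ Z ++ R))
      go []      = cong (_+ sum (map (quinv₂ e) (Z ++ R)))
        (flip-tallerˡ e f ad (cong suc ∣c∣) (subst (_< length e) (sym ∣c∣) lt))
      go (p ∷ P) = cong (quinv₂ e p +_) (go P)
    right : ∀ R → All (λ e → length e < r) R → All Admissibleᶜ R → sum (map (quinv₂ d) R) ≡ sum (map (quinv₂ c) R)
    right []      []         []        = refl
    right (e ∷ R) (lt ∷ ∣R∣) (ad ∷ adR) =
      cong₂ _+_ (flip-shorterʳ e f adc ad (cong suc ∣c∣) (subst (length e <_) (sym ∣c∣) lt)) (right R ∣R∣ adR)
    Σ-++ : ∀ (e : Column) → sum (map (quinv₂ e) (Z ++ R)) ≡ sum (map (quinv₂ e) Z) + sum (map (quinv₂ e) R)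
    Σ-++ e = trans (cong sum (map-++ (quinv₂ e) Z R)) (sum-++ (map (quinv₂ e) Z) _)
    inner : quinvᶜ (d ∷ Z ++ R) + #plain Z ≡ quinvᶜ (c ∷ Z ++ R) + 0
    inner = begin
      (sum (map (quinv₂ d) (Z ++ R)) + quinvᶜ (Z ++ R)) + #plain Z
        ≡⟨ cong (λ s → s + quinvᶜ (Z ++ R) + #plain Z) (Σ-++ d) ⟩
      ((sum (map (quinv₂ d) Z) + sum (map (quinv₂ d) R)) + quinvᶜ (Z ++ R)) + #plain Z
        ≡⟨ rearrange′ (sum (map (quinv₂ d) Z)) _ _ _ ⟩
      ((sum (map (quinv₂ d) Z) + #plain Z) + sum (map (quinv₂ d) R)) + quinvᶜ (Z ++ R)
        ≡⟨ cong₂ (λ s t → s + t + quinvᶜ (Z ++ R)) (flip-sum Z f ∣c∣ adc ∣Z∣ adZ) (right R ∣R∣ adR) ⟩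
      (sum (map (quinv₂ c) Z) + sum (map (quinv₂ c) R)) + quinvᶜ (Z ++ R)
        ≡⟨ cong (_+ quinvᶜ (Z ++ R)) (Σ-++ c) ⟨
      sum (map (quinv₂ c) (Z ++ R)) + quinvᶜ (Z ++ R)
        ≡⟨ +-identityʳ _ ⟨
      (sum (map (quinv₂ c) (Z ++ R)) + quinvᶜ (Z ++ R)) + 0  ∎

  -- The involution, as a relation between a filling whose central column has a positive top
  -- entry (superscript ⁺) and one where it is negative (superscript ⁻). Both arise from
  -- c± ∷ X, and `balance` makes the changes of quinv cancel.
  record Partner (cs⁺ cs⁻ : List Column) : Set where
    field
      {L P X T R W⁺ W⁻} : List Column
      {c⁺ c⁻}           : Column
      {k⁺ k⁻}           : ℕ
      eq⁺     : cs⁺ ≡ L ++ (P ++ W⁺ ++ T) ++ R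
      eq⁻     : cs⁻ ≡ L ++ (P ++ W⁻ ++ T) ++ R
      taller  : All (λ e → r < length e) L
      equalP  : All (λ e → length e ≡ r) P
      equalC  : length c⁺ ≡ r
      equalX  : All (λ e → length e ≡ r) X
      equalT  : All (λ e → length e ≡ r) T
      shorter : All (λ e → length e < r) R
      flips   : Flip c⁺ c⁻
      slide⁺  : Slide k⁺ c⁺ X W⁺
      slide⁻  : Slide k⁻ c⁻ X W⁻
      plain   : Plain X
      ends    : EndsMarked P
      starts  : StartsMarked T
      balance : k⁺ + k⁻ + length P ≡ length X + #plain T

  private
    regroup : ∀ (L P W T R : List Column) → L ++ (P ++ W ++ T) ++ R ≡ (L ++ P) ++ W ++ (T ++ R)
    regroup L P W T R = begin
      L ++ (P ++ W ++ T) ++ R    ≡⟨ cong (L ++_) (++-assoc P (W ++ T) R) ⟩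
      L ++ P ++ (W ++ T) ++ R    ≡⟨ ++-assoc L P _ ⟨
      (L ++ P) ++ (W ++ T) ++ R  ≡⟨ cong ((L ++ P) ++_) (++-assoc W T R) ⟩
      (L ++ P) ++ W ++ (T ++ R)  ∎
      where open ≡-Reasoning

  -- Comparing the statistics of two partners

  module _ {cs⁺ cs⁻ : List Column} (partner : Partner cs⁺ cs⁻) where

    open Partner partner

    private
      grouped⁺ : cs⁺ ≡ (L ++ P) ++ W⁺ ++ (T ++ R)
      grouped⁺ = trans eq⁺ (regroup L P W⁺ T R)
      grouped⁻ : cs⁻ ≡ (L ++ P) ++ W⁻ ++ (T ++ R)
      grouped⁻ = trans eq⁻ (regroup L P W⁻ T R)

    partner-parts : ∀ {P} → All (Rows P 1) cs⁺ →
      All (Rows P 1) (L ++ Partner.P partner) × All (Rows P 1) (c⁺ ∷ X) × All (Rows P 1) (T ++ R)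
    partner-parts ad =
      let ad′ = subst (All (Rows _ 1)) grouped⁺ ad
          adWTR = All.++⁻ʳ (L ++ P) ad′
      in All.++⁻ˡ (L ++ P) ad′ , unslide-rows slide⁺ (All.++⁻ˡ W⁺ adWTR) , All.++⁻ʳ W⁺ adWTR

    partner-rows⁻ : ∀ {P : ℕ → Letter → Set} → (∀ {ρ} → P ρ (pos n) → P ρ (neg n)) →
      All (Rows P 1) cs⁺ → All (Rows P 1) cs⁻
    partner-rows⁻ h ad with partner-parts ad
    ... | adLP , adc ∷ adX , adTR = subst (All (Rows _ 1)) (sym grouped⁻)
      (All.++⁺ adLP (All.++⁺ (slide-rows slide⁻ (flip-rows h flips adc ∷ adX)) adTR))

    partner-rows⁺ : ∀ {P : ℕ → Letter → Set} → (∀ {ρ} → P ρ (neg n) → P ρ (pos n)) →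
      All (Rows P 1) cs⁻ → All (Rows P 1) cs⁺
    partner-rows⁺ h ad with subst (All (Rows _ 1)) grouped⁻ ad
    ... | ad′ with All.++⁻ʳ (L ++ P) ad′
    ... | adWTR with unslide-rows slide⁻ (All.++⁻ˡ W⁻ adWTR)
    ... | adc ∷ adX = subst (All (Rows _ 1)) (sym grouped⁺)
      (All.++⁺ (All.++⁻ˡ (L ++ P) ad′)
        (All.++⁺ (slide-rows slide⁺ (unflip-rows h flips adc ∷ adX)) (All.++⁻ʳ W⁻ adWTR)))

    partner-length : map length cs⁻ ≡ map length cs⁺
    partner-length = begin
      map length cs⁻                                             ≡⟨ lengths grouped⁻ ⟩
      map length (L ++ P) ++ map length W⁻ ++ map length (T ++ R) ≡⟨ cong (λ w → map length (L ++ P) ++ w ++ map length (T ++ R)) W≡ ⟩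
      map length (L ++ P) ++ map length W⁺ ++ map length (T ++ R) ≡⟨ lengths grouped⁺ ⟨
      map length cs⁺                                             ∎
      where
      open ≡-Reasoning
      lengths : ∀ {cs W} → cs ≡ (L ++ P) ++ W ++ (T ++ R) →
        map length cs ≡ map length (L ++ P) ++ map length W ++ map length (T ++ R)
      lengths {W = W} eq = trans (cong (map length) eq) (trans (map-++ length (L ++ P) _)
        (cong (map length (L ++ P) ++_) (map-++ length W (T ++ R))))
      W≡ : map length W⁻ ≡ map length W⁺
      W≡ = trans (slide-length slide⁻) (trans (cong (_∷ map length X) (flip-length flips)) (sym (slide-length slide⁺)))

    partner-sum : ∀ (f : Column → ℕ) → (∀ {c d c′ d′} → Swap c d c′ d′ → f c′ + f d′ ≡ f c + f d) →
      sum (map f cs⁻) + f c⁺ ≡ sum (map f cs⁺) + f c⁻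
    partner-sum f inv = begin
      sum (map f cs⁻) + f c⁺                                              ≡⟨ cong (_+ f c⁺) (sums grouped⁻ slide⁻) ⟩
      (sum (map f (L ++ P)) + (f c⁻ + sum (map f (X ++ T ++ R)))) + f c⁺  ≡⟨ rearrange (sum (map f (L ++ P))) (f c⁻) _ (f c⁺) ⟩
      (sum (map f (L ++ P)) + (f c⁺ + sum (map f (X ++ T ++ R)))) + f c⁻  ≡⟨ cong (_+ f c⁻) (sums grouped⁺ slide⁺) ⟨
      sum (map f cs⁺) + f c⁻                                              ∎
      where
      open ≡-Reasoning
      rearrange : ∀ s x t y → (s + (x + t)) + y ≡ (s + (y + t)) + x
      rearrange = solve-∀
      sums : ∀ {cs k c W} → cs ≡ (L ++ P) ++ W ++ (T ++ R) → Slide k c X W →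
        sum (map f cs) ≡ sum (map f (L ++ P)) + (f c + sum (map f (X ++ T ++ R)))
      sums {W = W} eq sl = trans (cong (sum ∘ map f) eq)
        (trans (cong sum (map-++ f (L ++ P) (W ++ T ++ R)))
        (trans (sum-++ (map f (L ++ P)) _) (cong (sum (map f (L ++ P)) +_) (slide-sum f inv sl (T ++ R)))))

    partner-total : ∀ f → totalᶜ f cs⁻ + f (pos n) ≡ totalᶜ f cs⁺ + f (neg n)
    partner-total f = +-cancelʳ-≡ (total f c⁺) _ _ $ begin
      totalᶜ f cs⁻ + f (pos n) + total f c⁺   ≡⟨ xy∙z≈xz∙y (totalᶜ f cs⁻) _ _ ⟩
      totalᶜ f cs⁻ + total f c⁺ + f (pos n)   ≡⟨ cong (_+ f (pos n)) (partner-sum (total f) (swap-total f)) ⟩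
      totalᶜ f cs⁺ + total f c⁻ + f (pos n)   ≡⟨ +-assoc (totalᶜ f cs⁺) _ _ ⟩
      totalᶜ f cs⁺ + (total f c⁻ + f (pos n)) ≡⟨ cong (totalᶜ f cs⁺ +_) (trans (flip-total f flips) (+-comm (total f c⁺) _)) ⟩
      totalᶜ f cs⁺ + (f (neg n) + total f c⁺) ≡⟨ +-assoc (totalᶜ f cs⁺) _ _ ⟨
      totalᶜ f cs⁺ + f (neg n) + total f c⁺   ∎
      where open ≡-Reasoning

    module _ (ad : All Admissibleᶜ cs⁺) where

      private
        adL : All Admissibleᶜ L
        adL = All.++⁻ˡ L (proj₁ (partner-parts ad))
        adP : All Admissibleᶜ P
        adP = All.++⁻ʳ L (proj₁ (partner-parts ad))
        adc : Admissibleᶜ c⁺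
        adc = All.head (proj₁ (proj₂ (partner-parts ad)))
        adX : All Admissibleᶜ X
        adX = All.tail (proj₁ (proj₂ (partner-parts ad)))
        adT : All Admissibleᶜ T
        adT = All.++⁻ˡ T (proj₂ (proj₂ (partner-parts ad)))
        adR : All Admissibleᶜ R
        adR = All.++⁻ʳ T (proj₂ (proj₂ (partner-parts ad)))

        allBig : ∀ {Y} → All (λ e → length e ≡ r) Y → All Admissibleᶜ Y → Plain Y → All Big Y
        allBig []         []         []         = []
        allBig (∣e∣ ∷ ∣Y∣) (ad ∷ ads) (¬m ∷ pl) = plain⇒big ∣e∣ ad ¬m ∷ allBig ∣Y∣ ads pl

        big : All Big X
        big = allBig equalX adX plain

      partner-maj : majᶜ cs⁻ ≡ suc (majᶜ cs⁺)
      partner-maj = +-cancelʳ-≡ (maj₁ c⁺) _ _ $ trans (partner-sum maj₁ swap-maj)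
        (trans (cong (majᶜ cs⁺ +_) (flip-maj flips adc (cong suc equalC)
          (subst (1 <_) (sym equalC) (≤-trans (s≤s (s≤s z≤n)) n<r)))) (+-suc (majᶜ cs⁺) _))

      -- In cs⁺ the entry has `length X` - k⁺ + `#plain T` plain columns on its right; in cs⁻ it has
      -- `length P` + k⁻ block columns on its left, and `balance` equates the two. Both fillings are
      -- compared at the origin of the slides: there the flip changes quinv by `length P` -
      -- (`length X` + `#plain T`), and the slides contribute k⁺ + k⁻.
      partner-quinv : quinvᶜ cs⁻ ≡ quinvᶜ cs⁺
      partner-quinv = +-cancelʳ-≡ (length X + #plain T) _ _ $ begin
        quinvᶜ cs⁻ + (length X + #plain T)
          ≡⟨ cong (_+ (length X + #plain T)) q⁻ ⟩
        (quinvᶜ (base c⁻) + k⁻) + (length X + #plain T)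
          ≡⟨ xy∙z≈xz∙y (quinvᶜ (base c⁻)) k⁻ _ ⟩
        (quinvᶜ (base c⁻) + (length X + #plain T)) + k⁻
          ≡⟨ cong (_+ k⁻) q± ⟩
        (quinvᶜ (base c⁺) + length P) + k⁻
          ≡⟨ cong (λ q → q + length P + k⁻) q⁺ ⟨
        ((quinvᶜ cs⁺ + k⁺) + length P) + k⁻
          ≡⟨ rearrange (quinvᶜ cs⁺) k⁺ _ k⁻ ⟩
        quinvᶜ cs⁺ + (k⁺ + k⁻ + length P)
          ≡⟨ cong (quinvᶜ cs⁺ +_) balance ⟩
        quinvᶜ cs⁺ + (length X + #plain T)  ∎
        where
        open ≡-Reasoning
        base : Column → List Column
        base c = (L ++ P) ++ c ∷ X ++ T ++ R
        rearrange : ∀ q k p l → ((q + k) + p) + l ≡ q + (k + l + p)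
        rearrange = solve-∀
        rearrange′ : ∀ l m → l * 0 + m ≡ m
        rearrange′ = solve-∀
        lift : ∀ {k c W m m′} → Slide k c X W →
          quinvᶜ (W ++ T ++ R) + m ≡ quinvᶜ (c ∷ X ++ T ++ R) + m′ →
          quinvᶜ ((L ++ P) ++ W ++ T ++ R) + m ≡ quinvᶜ (base c) + m′
        lift {c = c} sl eq = trans
          (quinvᶜ-prefix (L ++ P) {δ = 0}
            (All.tabulate λ {e} _ → slide-sum (quinv₂ e) (λ s → swap-quinv₂ˡ s e) sl (T ++ R)) eq)
          (cong (quinvᶜ (base c) +_) (rearrange′ (length (L ++ P)) _))
        q⁺ : quinvᶜ cs⁺ + k⁺ ≡ quinvᶜ (base c⁺)
        q⁺ = trans (cong (λ cs → quinvᶜ cs + k⁺) grouped⁺) (trans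
          (lift slide⁺ (trans (slide-quinv⁺ slide⁺ (proj₁ (flip-last flips)) big (T ++ R)) (sym (+-identityʳ _))))
          (+-identityʳ _))
        q⁻ : quinvᶜ cs⁻ ≡ quinvᶜ (base c⁻) + k⁻
        q⁻ = trans (cong quinvᶜ grouped⁻) (trans (sym (+-identityʳ _))
          (lift slide⁻ (trans (+-identityʳ _) (slide-quinv⁻ slide⁻ (proj₂ (flip-last flips)) big (T ++ R)))))
        assoc : ∀ c → base c ≡ L ++ P ++ c ∷ (X ++ T) ++ R
        assoc c = trans (++-assoc L P _) (cong (λ Y → L ++ P ++ c ∷ Y) (sym (++-assoc X T R)))
        #X++T : #plain (X ++ T) ≡ length X + #plain T
        #X++T = trans (#plain-++ X T) (cong (_+ #plain T) (#plain-Plain plain))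
        q± : quinvᶜ (base c⁻) + (length X + #plain T) ≡ quinvᶜ (base c⁺) + length P
        q± = trans (cong₂ (λ cs m → quinvᶜ cs + m) (assoc c⁻) (sym #X++T))
          (trans (flip-quinvᶜ L P (X ++ T) R flips equalC adc taller equalP (All.++⁺ equalX equalT) shorter
                   adL adP (All.++⁺ adX adT) adR)
                 (cong (λ cs → quinvᶜ cs + length P) (sym (assoc c⁺))))

  -- Uniqueness and existence of the partner

  Above Equal Below : Column → Set
  Above c = r < length c
  Equal c = length c ≡ r
  Below c = length c < r

  record Blocks (cs L B R : List Column) : Set where
    constructor blocks
    field
      eq      : cs ≡ L ++ B ++ R
      taller  : All Above L
      equal   : All Equal B
      shorter : All Below R

  -- The three pieces are recovered from the whole list by filtering by height.
  blocks-unique : ∀ {cs L B R L′ B′ R′} → Blocks cs L B R → Blocks cs L′ B′ R′ → L ≡ L′ × B ≡ B′ × R ≡ R′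
  blocks-unique b b′ with split b | split b′
    where
    above? : ∀ c → Dec (Above c)
    above? c = suc r ≤? length c
    equal? : ∀ c → Dec (Equal c)
    equal? c = length c ≟ r
    below? : ∀ c → Dec (Below c)
    below? c = suc (length c) ≤? r
    filter₃ : ∀ {P : Column → Set} (P? : ∀ c → Dec (P c)) L B R →
      filter P? (L ++ B ++ R) ≡ filter P? L ++ filter P? B ++ filter P? R
    filter₃ P? L B R = trans (filter-++ P? L (B ++ R)) (cong (filter P? L ++_) (filter-++ P? B R))
    split : ∀ {cs L B R} → Blocks cs L B R → filter above? cs ≡ L × filter equal? cs ≡ B × filter below? cs ≡ R
    split {L = L} {B} {R} (blocks refl t e s) =
      trans (filter₃ above? L B R) (trans (cong₂ _++_ (filter-all above? t) (cong₂ _++_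
        (filter-none above? (All.map (λ eq lt → <-irrefl (sym eq) lt) e))
        (filter-none above? (All.map (λ lt gt → <-asym lt gt) s)))) (++-identityʳ L)) ,
      trans (filter₃ equal? L B R) (trans (cong₂ _++_ (filter-none equal? (All.map (λ lt eq → <-irrefl (sym eq) lt) t))
        (cong₂ _++_ (filter-all equal? e) (filter-none equal? (All.map (λ lt eq → <-irrefl eq lt) s)))) (++-identityʳ B)) ,
      trans (filter₃ below? L B R) (cong₂ _++_ (filter-none below? (All.map (λ lt gt → <-asym lt gt) t))
        (cong₂ _++_ (filter-none below? (All.map (λ eq lt → <-irrefl eq lt) e)) (filter-all below? s)))
  ... | refl , refl , refl | refl , refl , refl = refl , refl , refl

  blocks-exist : ∀ {cs} → AllPairs (λ c d → length d ≤ length c) cs → ∃[ L ] ∃[ B ] ∃[ R ] Blocks cs L B R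
  blocks-exist AllPairs.[] = [] , [] , [] , blocks refl [] [] []
  blocks-exist {c ∷ cs} (≤c AllPairs.∷ pairs) with <-cmp (length c) r | blocks-exist pairs
  ... | tri< lt _ _ | _ = [] , [] , c ∷ cs , blocks refl [] [] (lt ∷ All.map (λ le → ≤-<-trans le lt) ≤c)
  ... | tri> _ _ gt | L , B , R , blocks eq t e s = c ∷ L , B , R , blocks (cong (c ∷_) eq) (gt ∷ t) e s
  ... | tri≈ _ ∣c∣ _ | [] , B , R , blocks eq t e s = [] , c ∷ B , R , blocks (cong (c ∷_) eq) [] (∣c∣ ∷ e) s
  ... | tri≈ _ ∣c∣ _ | l ∷ L , B , R , blocks refl (gt ∷ _) e s =
    contradiction (≤-trans gt (≤-trans (All.head ≤c) (≤-reflexive ∣c∣))) (<-irrefl refl)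

  blocks-any : ∀ {cs L B R} → Blocks cs L B R → Any (λ c → Equal c × Marked c) cs → Any Marked B
  blocks-any {L = L} {B} (blocks refl t e s) any with Any.++⁻ L any
  ... | inj₁ anyL = contradiction anyL (All.All¬⇒¬Any (All.map (λ lt (eq , _) → <-irrefl (sym eq) lt) t))
  ... | inj₂ anyBR with Any.++⁻ B anyBR
  ...   | inj₁ anyB = Any.map proj₂ anyB
  ...   | inj₂ anyR = contradiction anyR (All.All¬⇒¬Any (All.map (λ lt (eq , _) → <-irrefl eq lt) s))

  -- A `Partner` as seen from one of its two fillings, regardless of the sign: k is how far the
  -- entry stands from the origin, k′ how far it will stand in the other filling.
  record Side (B P X T : List Column) (c : Column) (k k′ : ℕ) : Set where
    constructor side
    field
      {W}     : List Column
      eq      : B ≡ P ++ W ++ T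
      slide   : Slide k c X W
      marked  : Marked c
      plain   : Plain X
      ends    : EndsMarked P
      starts  : StartsMarked T
      k′≤     : k′ ≤ length X
      balance : k + k′ + length P ≡ length X + #plain T

  private
    regroup′ : ∀ (P Q : List Column) z S T → P ++ (Q ++ z ∷ S) ++ T ≡ (P ++ Q) ++ z ∷ (S ++ T)
    regroup′ P Q z S T = trans (cong (P ++_) (++-assoc Q (z ∷ S) T)) (sym (++-assoc P Q _))

  -- By `balance`, k′ + `length P` equals `length S + #plain T`. So `boundˡ` is the fact that k′ is
  -- not negative, and `boundʳ` is k′ ≤ `length X`.
  side-central : ∀ {B P X T c k k′} → (s : Side B P X T c k k′) →
    ∃[ Q ] ∃[ z ] ∃[ S ] Side.W s ≡ Q ++ z ∷ S × length Q ≡ k × last z ≡ last c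
      × B ≡ (P ++ Q) ++ z ∷ (S ++ T) × Central P Q z S T
  side-central {P = P} {X} {T} {k′ = k′} (side refl slide marked plain ends starts k′≤ balance)
    with slide-shape slide marked plain
  ... | Q , z , S , refl , refl , ∣X∣ , plQ , plS , mz , last≡ =
    Q , z , S , refl , refl , last≡ , regroup′ P Q z S T , record
    { marked = mz ; plainˡ = plQ ; plainʳ = plS ; ends = ends ; starts = starts
    ; boundˡ = ≤-trans (m≤n+m (length P) k′) (≤-reflexive (+-cancelˡ-≡ (length Q) _ _ (begin
        length Q + (k′ + length P)           ≡⟨ +-assoc (length Q) _ _ ⟨
        length Q + k′ + length P             ≡⟨ balance ⟩
        length X + #plain T                  ≡⟨ cong (_+ #plain T) ∣X∣ ⟨
        length Q + length S + #plain T       ≡⟨ +-assoc (length Q) _ _ ⟩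
        length Q + (length S + #plain T)     ∎)))
    ; boundʳ = +-cancelˡ-≤ (length X) _ _ (≤-trans (≤-reflexive (trans (sym balance) (rearrange (length Q) k′ _)))
        (+-monoˡ-≤ (length P + length Q) k′≤)) }
    where
    open ≡-Reasoning
    rearrange : ∀ q k p → q + k + p ≡ k + (p + q)
    rearrange = solve-∀

  -- The central column is determined by the block, undoing its slide returns c and X, and `balance`
  -- yields k′. As this works on either side, the partner of the partner is the original filling.
  side-unique : ∀ {B P X T c k k′ B₂ P₂ X₂ T₂ c₂ k₂ k₂′} →
    (s : Side B P X T c k k′) (s₂ : Side B₂ P₂ X₂ T₂ c₂ k₂ k₂′) → B ≡ B₂ →
    P ≡ P₂ × X ≡ X₂ × T ≡ T₂ × c ≡ c₂ × k′ ≡ k₂′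
  side-unique {P = P} {k = k} s s₂ B≡ with side-central s | side-central s₂
  ... | Q , z , S , refl , refl , _ , eq , cen | Q₂ , z₂ , S₂ , refl , refl , _ , eq₂ , cen₂
    with central-unique cen cen₂ (trans (sym eq) (trans B≡ eq₂))
  ... | refl , refl , refl , refl , refl with slide-injective (Side.slide s) (Side.slide s₂)
  ... | refl , refl = refl , refl , refl , refl ,
    +-cancelˡ-≡ k _ _ (+-cancelʳ-≡ (length P) _ _ (trans (Side.balance s) (sym (Side.balance s₂))))

  module _ {cs⁺ cs⁻ : List Column} (partner : Partner cs⁺ cs⁻) where

    open Partner partner

    private
      marked⁺ : Marked c⁺
      marked⁺ = cong (Maybe.map ∣_∣) (proj₁ (flip-last flips))

      marked⁻ : Marked c⁻
      marked⁻ = cong (Maybe.map ∣_∣) (proj₂ (flip-last flips))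

      equal-B : ∀ {k c W} → length c ≡ r → Slide k c X W → All Equal (P ++ W ++ T)
      equal-B {c = c} {W} ∣c∣ sl = All.++⁺ equalP (All.++⁺
        (all-length {_≡ r} (c ∷ X) W (sym (slide-length sl)) (∣c∣ ∷ equalX)) equalT)

    blocks⁺ : Blocks cs⁺ L (P ++ W⁺ ++ T) R
    blocks⁺ = blocks eq⁺ taller (equal-B equalC slide⁺) shorter

    blocks⁻ : Blocks cs⁻ L (P ++ W⁻ ++ T) R
    blocks⁻ = blocks eq⁻ taller (equal-B (trans (flip-length flips) equalC) slide⁻) shorter

    side⁺ : Side (P ++ W⁺ ++ T) P X T c⁺ k⁺ k⁻
    side⁺ = side refl slide⁺ marked⁺ plain ends starts (slide-≤ slide⁻) balance

    side⁻ : Side (P ++ W⁻ ++ T) P X T c⁻ k⁻ k⁺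
    side⁻ = side refl slide⁻ marked⁻ plain ends starts (slide-≤ slide⁺)
      (trans (cong (_+ length P) (+-comm k⁻ k⁺)) balance)

    private
      central-any : ∀ {cs k k′ c W} → Blocks cs L (P ++ W ++ T) R → Side (P ++ W ++ T) P X T c k k′ →
        Any (λ c → Equal c × Marked c) cs
      central-any (blocks refl _ e _) s with side-central s
      ... | Q , z , S , _ , _ , _ , eq , cen = Any.++⁺ʳ L (Any.++⁺ˡ (subst (Any _) (sym eq) (Any.++⁺ʳ (P ++ Q)
        (here (All.head (All.++⁻ʳ (P ++ Q) (subst (All Equal) eq e)) , Central.marked cen)))))

    partner-any⁺ : Any (λ c → Equal c × Marked c) cs⁺
    partner-any⁺ = central-any blocks⁺ side⁺

    partner-any⁻ : Any (λ c → Equal c × Marked c) cs⁻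
    partner-any⁻ = central-any blocks⁻ side⁻

  partner-functional : ∀ {cs cs⁻ cs⁻′} → Partner cs cs⁻ → Partner cs cs⁻′ → cs⁻ ≡ cs⁻′
  partner-functional p@record{} p′@record{} with blocks-unique (blocks⁺ p) (blocks⁺ p′)
  ... | L≡ , B≡ , R≡ with side-unique (side⁺ p) (side⁺ p′) B≡
  ... | refl , refl , refl , refl , refl with flip-functional (Partner.flips p) (Partner.flips p′)
  ... | refl with slide-functional (Partner.slide⁻ p) (Partner.slide⁻ p′)
  ... | refl = trans (Partner.eq⁻ p) (trans (cong₂ (λ L R → L ++ _ ++ R) L≡ R≡) (sym (Partner.eq⁻ p′)))

  partner-injective : ∀ {cs cs⁺ cs⁺′} → Partner cs⁺ cs → Partner cs⁺′ cs → cs⁺ ≡ cs⁺′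
  partner-injective p@record{} p′@record{} with blocks-unique (blocks⁻ p) (blocks⁻ p′)
  ... | L≡ , B≡ , R≡ with side-unique (side⁻ p) (side⁻ p′) B≡
  ... | refl , refl , refl , refl , refl with flip-injective (Partner.flips p) (Partner.flips p′)
  ... | refl with slide-functional (Partner.slide⁺ p) (Partner.slide⁺ p′)
  ... | refl = trans (Partner.eq⁺ p) (trans (cong₂ (λ L R → L ++ _ ++ R) L≡ R≡) (sym (Partner.eq⁺ p′)))

  -- The two roles would give the unique central column a positive and a negative top entry at once.
  partner-antisym : ∀ {cs cs⁺ cs⁻} → Partner cs cs⁻ → ¬ Partner cs⁺ cs
  partner-antisym p@record{} p′@record{} with blocks-unique (blocks⁺ p) (blocks⁻ p′)
  ... | L≡ , B≡ , R≡ with side-unique (side⁺ p) (side⁻ p′) B≡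
  ... | refl , refl , refl , refl , refl
    with () ← trans (sym (proj₁ (flip-last (Partner.flips p)))) (proj₂ (flip-last (Partner.flips p′)))

  marked-last : ∀ c → Marked c → last c ≡ just (pos n) ⊎ last c ≡ just (neg n)
  marked-last c m with last c
  marked-last c refl | just (pos _) = inj₁ refl
  marked-last c refl | just (neg _) = inj₂ refl

  partner-exists : ∀ {cs} → AllPairs (λ c d → length d ≤ length c) cs →
    Any (λ c → Equal c × Marked c) cs → (∃[ cs⁻ ] Partner cs cs⁻) ⊎ (∃[ cs⁺ ] Partner cs⁺ cs)
  partner-exists pairs any with blocks-exist pairs
  ... | L , B , R , b@(blocks refl t e s) with central-exists (blocks-any b any)
  ... | P , Q , z , S , T , refl , cen with All.++⁻ʳ P (subst (All Equal) (sym (regroup′ P Q z S T)) e)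
  ... | eWT with All.++⁻ˡ (Q ++ z ∷ S) eWT
  ... | eW with unslide-exists (≤-trans (s≤s z≤n) n<r) Q z S eW
  ... | c , X , sl with all-length {_≡ r} (Q ++ z ∷ S) (c ∷ X) (slide-length sl) eW
  ... | ∣c∣ ∷ ∣X∣ with unslide-shape Q sl (Central.plainˡ cen) (Central.plainʳ cen)
  ... | plX , last≡ = result z-top
    where
    r>0 : 0 < r
    r>0 = ≤-trans (s≤s z≤n) n<r

    ∣X∣≡ : length X ≡ length Q + length S
    ∣X∣≡ = suc-injective (begin
      suc (length X)                    ≡⟨ length-map length (c ∷ X) ⟨
      length (map length (c ∷ X))       ≡⟨ cong length (slide-length sl) ⟨
      length (map length (Q ++ z ∷ S))  ≡⟨ length-map length (Q ++ z ∷ S) ⟩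
      length (Q ++ z ∷ S)               ≡⟨ length-++ Q ⟩
      length Q + suc (length S)         ≡⟨ +-suc (length Q) _ ⟩
      suc (length Q + length S)         ∎)
      where open ≡-Reasoning

    -- The target has `length S + #plain T` block columns on its left, the first `length P` of which
    -- precede the origin. `boundˡ` makes the truncated subtraction exact.
    k′ : ℕ
    k′ = (length S + #plain T) ∸ length P

    k′≡ : k′ + length P ≡ length S + #plain T
    k′≡ = m∸n+n≡m (Central.boundˡ cen)

    k′≤ : k′ ≤ length X
    k′≤ = +-cancelʳ-≤ (length P) _ _ (begin
      k′ + length P                      ≡⟨ k′≡ ⟩
      length S + #plain T                ≤⟨ +-monoʳ-≤ (length S) (Central.boundʳ cen) ⟩
      length S + (length P + length Q)   ≡⟨ rearrange (length S) (length P) (length Q) ⟩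
      length Q + length S + length P     ≡⟨ cong (_+ length P) ∣X∣≡ ⟨
      length X + length P                ∎)
      where
      open ≤-Reasoning
      rearrange : ∀ s p q → s + (p + q) ≡ q + s + p
      rearrange = solve-∀

    balance : length Q + k′ + length P ≡ length X + #plain T
    balance = begin
      length Q + k′ + length P           ≡⟨ +-assoc (length Q) k′ _ ⟩
      length Q + (k′ + length P)         ≡⟨ cong (length Q +_) k′≡ ⟩
      length Q + (length S + #plain T)   ≡⟨ +-assoc (length Q) _ _ ⟨
      length Q + length S + #plain T     ≡⟨ cong (_+ #plain T) ∣X∣≡ ⟨
      length X + #plain T                ∎
      where open ≡-Reasoning

    z-top : last c ≡ just (pos n) ⊎ last c ≡ just (neg n)
    z-top = Sum.map (trans last≡) (trans last≡) (marked-last z (Central.marked cen))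

    regrouped : L ++ ((P ++ Q) ++ z ∷ (S ++ T)) ++ R ≡ L ++ (P ++ (Q ++ z ∷ S) ++ T) ++ R
    regrouped = cong (λ B → L ++ B ++ R) (sym (regroup′ P Q z S T))

    eP : All Equal P
    eP = All.++⁻ˡ P (subst (All Equal) (sym (regroup′ P Q z S T)) e)

    result : last c ≡ just (pos n) ⊎ last c ≡ just (neg n) →
      (∃[ cs⁻ ] Partner (L ++ ((P ++ Q) ++ z ∷ (S ++ T)) ++ R) cs⁻) ⊎
      (∃[ cs⁺ ] Partner cs⁺ (L ++ ((P ++ Q) ++ z ∷ (S ++ T)) ++ R))
    result (inj₁ pos-top) =
      let d , f = flip-exists pos-top
          W , sl′ = slide-exists r>0 k′ d X (trans (flip-length f) ∣c∣) ∣X∣ k′≤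
      in inj₁ (_ , record
        { eq⁺ = regrouped ; eq⁻ = refl
        ; taller = t ; equalP = eP ; equalC = ∣c∣ ; equalX = ∣X∣ ; equalT = All.++⁻ʳ (Q ++ z ∷ S) eWT ; shorter = s
        ; flips = f ; slide⁺ = sl ; slide⁻ = sl′ ; plain = plX
        ; ends = Central.ends cen ; starts = Central.starts cen ; balance = balance })
    result (inj₂ neg-top) =
      let d , f = unflip-exists neg-top
          ∣d∣ = trans (sym (flip-length f)) ∣c∣
          W , sl′ = slide-exists r>0 k′ d X ∣d∣ ∣X∣ k′≤
      in inj₂ (_ , record
        { eq⁺ = refl ; eq⁻ = regrouped
        ; taller = t ; equalP = eP ; equalC = ∣d∣ ; equalX = ∣X∣ ; equalT = All.++⁻ʳ (Q ++ z ∷ S) eWT ; shorter = s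
        ; flips = f ; slide⁺ = sl′ ; slide⁻ = sl ; plain = plX
        ; ends = Central.ends cen ; starts = Central.starts cen
        ; balance = trans (cong (_+ length P) (+-comm k′ (length Q))) balance })

-- Sums over cells

Σᶠ : ∀ n → (Fin n → ℕ) → ℕ
Σᶠ zero    f = 0
Σᶠ (suc n) f = f zero + Σᶠ n (f ∘ suc)

Σᶠ-cong : ∀ n {f g : Fin n → ℕ} → (∀ i → f i ≡ g i) → Σᶠ n f ≡ Σᶠ n g
Σᶠ-cong zero    _  = refl
Σᶠ-cong (suc n) eq = cong₂ _+_ (eq zero) (Σᶠ-cong n (eq ∘ suc))

Σᶠ-zero : ∀ n {f : Fin n → ℕ} → (∀ i → f i ≡ 0) → Σᶠ n f ≡ 0
Σᶠ-zero zero    _  = refl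
Σᶠ-zero (suc n) eq = cong₂ _+_ (eq zero) (Σᶠ-zero n (eq ∘ suc))

Σᶠ-+ : ∀ n (f g : Fin n → ℕ) → Σᶠ n (λ i → f i + g i) ≡ Σᶠ n f + Σᶠ n g
Σᶠ-+ zero    f g = refl
Σᶠ-+ (suc n) f g = trans (cong (f zero + g zero +_) (Σᶠ-+ n (f ∘ suc) (g ∘ suc))) (interchange (f zero) _ _ _)

Σᶠ-* : ∀ n c (f : Fin n → ℕ) → Σᶠ n (λ i → c * f i) ≡ c * Σᶠ n f
Σᶠ-* zero    c f = sym (*-zeroʳ c)
Σᶠ-* (suc n) c f = trans (cong (c * f zero +_) (Σᶠ-* n c (f ∘ suc))) (sym (*-distribˡ-+ c (f zero) _))

Σᶠ-swap : ∀ m n (f : Fin m → Fin n → ℕ) → Σᶠ m (λ i → Σᶠ n (f i)) ≡ Σᶠ n (λ j → Σᶠ m (λ i → f i j))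
Σᶠ-swap zero    n f = sym (Σᶠ-zero n λ _ → refl)
Σᶠ-swap (suc m) n f = trans (cong (Σᶠ n (f zero) +_) (Σᶠ-swap m n (f ∘ suc))) (sym (Σᶠ-+ n (f zero) _))

sum-allFin : ∀ n (f : Fin n → ℕ) → sum (map f (allFin n)) ≡ Σᶠ n f
sum-allFin n f = go n (λ i → i)
  where
  go : ∀ m (g : Fin m → Fin n) → sum (map f (tabulate g)) ≡ Σᶠ m (f ∘ g)
  go zero    g = refl
  go (suc m) g = cong (f (g zero) +_) (go m (g ∘ suc))

sum-map-++ : ∀ {A : Set} (f : A → ℕ) xs ys → sum (map f (xs ++ ys)) ≡ sum (map f xs) + sum (map f ys)
sum-map-++ f xs ys = trans (cong sum (map-++ f xs ys)) (sum-++ (map f xs) _)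

sum-concatMap : ∀ {A B : Set} (f : A → ℕ) (h : B → List A) xs →
  sum (map f (concatMap h xs)) ≡ sum (map (λ x → sum (map f (h x))) xs)
sum-concatMap f h []       = refl
sum-concatMap f h (x ∷ xs) =
  trans (sum-map-++ f (h x) _) (cong (sum (map f (h x)) +_) (sum-concatMap f h xs))

sum-cartesianProduct : ∀ {A B : Set} (f : A × B → ℕ) xs ys →
  sum (map f (cartesianProduct xs ys)) ≡ sum (map (λ x → sum (map (λ y → f (x , y)) ys)) xs)
sum-cartesianProduct f []       ys = refl
sum-cartesianProduct f (x ∷ xs) ys = trans (sum-map-++ f (map (x ,_) ys) _)
  (cong₂ _+_ (cong sum (sym (map-∘ ys))) (sum-cartesianProduct f xs ys))

length-filter-sum : ∀ {A : Set} {P : A → Set} (P? : ∀ x → Dec (P x)) xs → length (filter P? xs) ≡ sum (map (𝟙 ∘ P?) xs)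
length-filter-sum P? []       = refl
length-filter-sum P? (x ∷ xs) with P? x
... | yes _ = cong suc (length-filter-sum P? xs)
... | no  _ = length-filter-sum P? xs

sum-filter : ∀ {A : Set} {P : A → Set} (P? : ∀ x → Dec (P x)) (f : A → ℕ) xs →
  sum (map f (filter P? xs)) ≡ sum (map (λ x → 𝟙 (P? x) * f x) xs)
sum-filter P? f []       = refl
sum-filter P? f (x ∷ xs) with P? x
... | yes _ = cong₂ _+_ (sym (+-identityʳ (f x))) (sum-filter P? f xs)
... | no  _ = sum-filter P? f xs

𝟙-× : ∀ {P Q : Set} (P? : Dec P) (Q? : Dec Q) → 𝟙 (P? ×-dec Q?) ≡ 𝟙 P? * 𝟙 Q?
𝟙-× (yes _) Q? = sym (+-identityʳ _)
𝟙-× (no  _) Q? = refl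

-- Columns of a filling

column : ∀ {hs} → All (Vec Letter) hs → (i : Fin (length hs)) → Vec Letter (List.lookup hs i)
column σ i = All.lookup σ (∈-lookup i)

columns : ∀ {hs} → All (Vec Letter) hs → List Column
columns []      = []
columns (v ∷ σ) = toList v ∷ columns σ

columns-length : ∀ {hs} (σ : All (Vec Letter) hs) → map length (columns σ) ≡ hs
columns-length []      = refl
columns-length (v ∷ σ) = cong₂ _∷_ (length-toList v) (columns-length σ)

toList-injective : ∀ {h} (v w : Vec Letter h) → toList v ≡ toList w → v ≡ w
toList-injective []      []      _  = refl
toList-injective (x ∷ v) (y ∷ w) eq = cong₂ _∷_ (∷-injectiveˡ eq) (toList-injective v w (∷-injectiveʳ eq))

columns-injective : ∀ {hs} (σ τ : All (Vec Letter) hs) → columns σ ≡ columns τ → σ ≡ τ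
columns-injective []      []      _  = refl
columns-injective (v ∷ σ) (w ∷ τ) eq =
  cong₂ _∷_ (toList-injective v w (∷-injectiveˡ eq)) (columns-injective σ τ (∷-injectiveʳ eq))

columns-surjective : ∀ {hs} cs → map length cs ≡ hs → ∃[ σ ] columns {hs} σ ≡ cs
columns-surjective []       refl = [] , refl
columns-surjective (c ∷ cs) refl =
  let σ , eq = columns-surjective cs refl in Vec.fromList c ∷ σ , cong₂ _∷_ (toList∘fromList c) eq

columns-sum : ∀ (f : Column → ℕ) {hs} (σ : All (Vec Letter) hs) →
  Σᶠ (length hs) (λ i → f (toList (column σ i))) ≡ sum (map f (columns σ))
columns-sum f []      = refl
columns-sum f (v ∷ σ) = cong (f (toList v) +_) (columns-sum f σ)

total-toList : ∀ (f : Letter → ℕ) {h} (v : Vec Letter h) → Σᶠ h (λ ρ → f (lookup v ρ)) ≡ total f (toList v)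
total-toList f []      = refl
total-toList f (x ∷ v) = cong (f x +_) (total-toList f v)

𝟙-I : ∀ a b → 𝟙 (I a (just b) ≟ 1) ≡ J a b
𝟙-I a b with 𝟙-01 ((just b <₂? a) ⊎-dec equalNegative? a (just b))
... | inj₁ eq = trans (cong (λ i → 𝟙 (i ≟ 1)) eq) (sym (trans (J≡I a b) eq))
... | inj₂ eq = trans (cong (λ i → 𝟙 (i ≟ 1)) eq) (sym (trans (J≡I a b) eq))

maj-toList : ∀ {h} (v : Vec Letter h) →
  Σᶠ h (λ ρ → 𝟙 ((1 <? suc (toℕ ρ)) ×-dec (I (just (lookup v ρ)) (just (lookup v (Fin.pred ρ))) ≟ 1))
              * ((h ∸ suc (toℕ ρ)) + 1)) ≡ maj₁ (toList v)
maj-toList []      = refl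
maj-toList (b ∷ v) = go b v
  where
  -- The bottom cell is never a descent and is split off. The cells of v are then indexed from row 2
  -- on, and the entry below the one at ρ is found in `b ∷ v` at `inject₁ ρ`.
  go : ∀ b {h} (v : Vec Letter h) →
    Σᶠ h (λ ρ → 𝟙 (I (just (lookup v ρ)) (just (lookup (b ∷ v) (Fin.inject₁ ρ))) ≟ 1)
                * ((h ∸ suc (toℕ ρ)) + 1)) ≡ maj₁ (b ∷ toList v)
  go b []              = refl
  go b {suc h} (a ∷ v) = cong₂ _+_ (begin
    𝟙 (I (just a) (just b) ≟ 1) * (h + 1)  ≡⟨ cong₂ _*_ (𝟙-I (just a) b) (+-comm h 1) ⟩
    J (just a) b * suc h                   ≡⟨ *-comm (J (just a) b) _ ⟩
    suc h * J (just a) b                   ≡⟨ cong (λ l → suc l * J (just a) b) (length-toList v) ⟨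
    suc (length (toList v)) * J (just a) b ∎)
    (go a v)
    where open ≡-Reasoning

-- Indexing that returns the extra symbol 0 beyond the top, so that it agrees with the entry above a
-- cell also for degenerate triples.
at : Column → ℕ → Letter₀
at []      _       = nothing
at (x ∷ c) zero    = just x
at (x ∷ c) (suc k) = at c k

at-zero : ∀ c → at c 0 ≡ head c
at-zero []      = refl
at-zero (_ ∷ _) = refl

at-lookup : ∀ {h} (v : Vec Letter h) (ρ : Fin h) → at (toList v) (toℕ ρ) ≡ just (lookup v ρ)
at-lookup (x ∷ v) zero    = refl
at-lookup (x ∷ v) (suc ρ) = at-lookup v ρ

at-≥ : ∀ {h} (v : Vec Letter h) k → h ≤ k → at (toList v) k ≡ nothing
at-≥ []      k       _   = refl
at-≥ (x ∷ v) (suc k) h≤k = at-≥ v k (s≤s⁻¹ h≤k)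

quinv₂-toList : ∀ {h h′} (v : Vec Letter h) (w : Vec Letter h′) →
  Σᶠ h (λ ρ → Σᶠ h′ (λ ρ′ → 𝟙 (suc (toℕ ρ) ≟ suc (toℕ ρ′))
    * quinv₃ (at (toList v) (suc (toℕ ρ))) (lookup v ρ) (lookup w ρ′))) ≡ quinv₂ (toList v) (toList w)
quinv₂-toList []      w  = refl
quinv₂-toList {suc h} (b ∷ v) [] = Σᶠ-zero (suc h) (λ _ → refl)
quinv₂-toList {suc h} {suc h′} (b ∷ v) (x ∷ w) = cong₂ _+_
  (trans (cong₂ _+_ (trans (+-identityʳ _) (cong (λ a → quinv₃ a b x) (at-zero (toList v)))) (Σᶠ-zero h′ λ _ → refl))
         (+-identityʳ _))
  (quinv₂-toList v w)

quinvᶜ-columns : ∀ {hs} (σ : All (Vec Letter) hs) →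
  Σᶠ (length hs) (λ i → Σᶠ (length hs) (λ j → 𝟙 (i Fin.<? j) * quinv₂ (toList (column σ i)) (toList (column σ j))))
  ≡ quinvᶜ (columns σ)
quinvᶜ-columns []      = refl
quinvᶜ-columns {h ∷ hs} (v ∷ σ) = cong₂ _+_
  (trans (Σᶠ-cong (length hs) λ _ → +-identityʳ _) (columns-sum (quinv₂ (toList v)) σ))
  (quinvᶜ-columns σ)

-- The statistics of a filling in terms of its columns

module Statistics (μ : Partition) where

  open Partition μ

  sum-cells : ∀ (f : Cell μ → ℕ) →
    sum (map f (cells μ)) ≡ Σᶠ #columns (λ i → Σᶠ (part i) (λ ρ → f (i , ρ)))
  sum-cells f = begin
    sum (map f (cells μ))
      ≡⟨ sum-concatMap f (λ i → map (i ,_) (allFin (part i))) (allFin #columns) ⟩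
    sum (map (λ i → sum (map f (map (i ,_) (allFin (part i))))) (allFin #columns))
      ≡⟨ sum-allFin #columns _ ⟩
    Σᶠ #columns (λ i → sum (map f (map (i ,_) (allFin (part i)))))
      ≡⟨ Σᶠ-cong #columns (λ i → trans (cong sum (sym (map-∘ (allFin (part i))))) (sum-allFin (part i) _)) ⟩
    Σᶠ #columns (λ i → Σᶠ (part i) (λ ρ → f (i , ρ)))  ∎
    where open ≡-Reasoning

  count-columns : ∀ {P : Letter → Set} (P? : ∀ x → Dec (P x)) (σ : Filling μ) →
    length (filter (λ u → P? (_⟨_⟩ μ σ u)) (cells μ)) ≡ totalᶜ (𝟙 ∘ P?) (columns σ)
  count-columns P? σ = begin
    length (filter (λ u → P? (_⟨_⟩ μ σ u)) (cells μ))
      ≡⟨ length-filter-sum (λ u → P? (_⟨_⟩ μ σ u)) (cells μ) ⟩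
    sum (map (λ u → 𝟙 (P? (_⟨_⟩ μ σ u))) (cells μ))
      ≡⟨ sum-cells _ ⟩
    Σᶠ #columns (λ i → Σᶠ (part i) (λ ρ → 𝟙 (P? (lookup (column σ i) ρ))))
      ≡⟨ Σᶠ-cong #columns (λ i → total-toList (𝟙 ∘ P?) (column σ i)) ⟩
    Σᶠ #columns (λ i → total (𝟙 ∘ P?) (toList (column σ i)))
      ≡⟨ columns-sum (total (𝟙 ∘ P?)) σ ⟩
    totalᶜ (𝟙 ∘ P?) (columns σ)  ∎
    where open ≡-Reasoning

  maj-columns : ∀ σ → maj μ σ ≡ majᶜ (columns σ)
  maj-columns σ = begin
    maj μ σ
      ≡⟨ sum-filter (descent? μ σ) (λ u → leg μ u + 1) (cells μ) ⟩
    sum (map (λ u → 𝟙 (descent? μ σ u) * (leg μ u + 1)) (cells μ))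
      ≡⟨ sum-cells _ ⟩
    Σᶠ #columns (λ i → Σᶠ (part i) (λ ρ → 𝟙 (descent? μ σ (i , ρ)) * (leg μ (i , ρ) + 1)))
      ≡⟨ Σᶠ-cong #columns (λ i → maj-toList (column σ i)) ⟩
    Σᶠ #columns (λ i → maj₁ (toList (column σ i)))
      ≡⟨ columns-sum maj₁ σ ⟩
    majᶜ (columns σ)  ∎
    where open ≡-Reasoning

  above-at : ∀ σ i ρ → _⟨_⟩₀ μ σ (above μ (i , ρ)) ≡ at (toList (column σ i)) (suc (toℕ ρ))
  above-at σ i ρ with suc (toℕ ρ) <? part i
  ... | yes lt = sym (trans (cong (at (toList (column σ i))) (sym (Fin.toℕ-fromℕ< lt)))
                            (at-lookup (column σ i) (fromℕ< lt)))
  ... | no ≮   = sym (at-≥ (column σ i) _ (≮⇒≥ ≮))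

  quinvTriple-𝟙 : ∀ σ i ρ j ρ′ → 𝟙 (quinvTriple? μ σ (i , ρ) (j , ρ′)) ≡
    𝟙 (i Fin.<? j) * (𝟙 (suc (toℕ ρ) ≟ suc (toℕ ρ′))
      * quinv₃ (at (toList (column σ i)) (suc (toℕ ρ))) (lookup (column σ i) ρ) (lookup (column σ j) ρ′))
  quinvTriple-𝟙 σ i ρ j ρ′ = begin
    𝟙 (quinvTriple? μ σ (i , ρ) (j , ρ′))
      ≡⟨ 𝟙-× (triple? μ (i , ρ) (j , ρ′)) (I a (just b) + (1 ∸ I (just c) (just b)) + (1 ∸ I a (just c)) ≟ 1) ⟩
    𝟙 (triple? μ (i , ρ) (j , ρ′)) * 𝟙 (I a (just b) + (1 ∸ I (just c) (just b)) + (1 ∸ I a (just c)) ≟ 1)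
      ≡⟨ cong₂ _*_ (𝟙-× (suc (toℕ ρ) ≟ suc (toℕ ρ′)) (i Fin.<? j)) triple ⟩
    (rows * cols) * quinv₃ (at (toList (column σ i)) (suc (toℕ ρ))) b c
      ≡⟨ rearrange rows cols _ ⟩
    cols * (rows * quinv₃ (at (toList (column σ i)) (suc (toℕ ρ))) b c)  ∎
    where
    open ≡-Reasoning
    a = _⟨_⟩₀ μ σ (above μ (i , ρ))
    b = lookup (column σ i) ρ
    c = lookup (column σ j) ρ′
    rows = 𝟙 (suc (toℕ ρ) ≟ suc (toℕ ρ′))
    cols = 𝟙 (i Fin.<? j)
    rearrange : ∀ x y z → (x * y) * z ≡ y * (x * z)
    rearrange = solve-∀
    triple : 𝟙 (I a (just b) + (1 ∸ I (just c) (just b)) + (1 ∸ I a (just c)) ≟ 1)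
      ≡ quinv₃ (at (toList (column σ i)) (suc (toℕ ρ))) b c
    triple = begin
      𝟙 (I a (just b) + (1 ∸ I (just c) (just b)) + (1 ∸ I a (just c)) ≟ 1)
        ≡⟨ cong (λ z → 𝟙 (I a (just b) + (1 ∸ I (just c) (just b)) + (1 ∸ z) ≟ 1)) (J≡I a c) ⟨
      𝟙 (I a (just b) + (1 ∸ I (just c) (just b)) + (1 ∸ J a c) ≟ 1)
        ≡⟨ cong₂ (λ x y → 𝟙 (x + (1 ∸ y) + (1 ∸ J a c) ≟ 1)) (J≡I a b) (J≡I (just c) b) ⟨
      𝟙 (J a b + (1 ∸ J (just c) b) + (1 ∸ J a c) ≟ 1)
        ≡⟨ quinv₃≡𝟙 a b c ⟨
      quinv₃ a b c
        ≡⟨ cong (λ a → quinv₃ a b c) (above-at σ i ρ) ⟩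
      quinv₃ (at (toList (column σ i)) (suc (toℕ ρ))) b c  ∎

  quinv-columns : ∀ σ → quinv μ σ ≡ quinvᶜ (columns σ)
  quinv-columns σ = begin
    quinv μ σ
      ≡⟨ length-filter-sum (uncurry (quinvTriple? μ σ)) (cartesianProduct (cells μ) (cells μ)) ⟩
    sum (map (𝟙 ∘ uncurry (quinvTriple? μ σ)) (cartesianProduct (cells μ) (cells μ)))
      ≡⟨ sum-cartesianProduct (𝟙 ∘ uncurry (quinvTriple? μ σ)) (cells μ) (cells μ) ⟩
    sum (map (λ u → sum (map (λ v → 𝟙 (quinvTriple? μ σ u v)) (cells μ))) (cells μ))
      ≡⟨ sum-cells _ ⟩
    Σᶠ #columns (λ i → Σᶠ (part i) (λ ρ → sum (map (λ v → 𝟙 (quinvTriple? μ σ (i , ρ) v)) (cells μ))))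
      ≡⟨ Σᶠ-cong #columns (λ i → Σᶠ-cong (part i) λ ρ → sum-cells _) ⟩
    Σᶠ #columns (λ i → Σᶠ (part i) (λ ρ → Σᶠ #columns (λ j → Σᶠ (part j) (λ ρ′ →
      𝟙 (quinvTriple? μ σ (i , ρ) (j , ρ′))))))
      ≡⟨ Σᶠ-cong #columns (λ i → Σᶠ-swap (part i) #columns _) ⟩
    Σᶠ #columns (λ i → Σᶠ #columns (λ j → Σᶠ (part i) (λ ρ → Σᶠ (part j) (λ ρ′ →
      𝟙 (quinvTriple? μ σ (i , ρ) (j , ρ′))))))
      ≡⟨ Σᶠ-cong #columns (λ i → Σᶠ-cong #columns λ j → pair i j) ⟩
    Σᶠ #columns (λ i → Σᶠ #columns (λ j → 𝟙 (i Fin.<? j) * quinv₂ (toList (column σ i)) (toList (column σ j))))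
      ≡⟨ quinvᶜ-columns σ ⟩
    quinvᶜ (columns σ)  ∎
    where
    open ≡-Reasoning
    term : ∀ i j → Fin (part i) → Fin (part j) → ℕ
    term i j ρ ρ′ = 𝟙 (suc (toℕ ρ) ≟ suc (toℕ ρ′))
      * quinv₃ (at (toList (column σ i)) (suc (toℕ ρ))) (lookup (column σ i) ρ) (lookup (column σ j) ρ′)
    pair : ∀ i j → Σᶠ (part i) (λ ρ → Σᶠ (part j) (λ ρ′ → 𝟙 (quinvTriple? μ σ (i , ρ) (j , ρ′))))
      ≡ 𝟙 (i Fin.<? j) * quinv₂ (toList (column σ i)) (toList (column σ j))
    pair i j = begin
      Σᶠ (part i) (λ ρ → Σᶠ (part j) (λ ρ′ → 𝟙 (quinvTriple? μ σ (i , ρ) (j , ρ′))))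
        ≡⟨ Σᶠ-cong (part i) (λ ρ → trans (Σᶠ-cong (part j) λ ρ′ → quinvTriple-𝟙 σ i ρ j ρ′)
                                         (Σᶠ-* (part j) (𝟙 (i Fin.<? j)) (term i j ρ))) ⟩
      Σᶠ (part i) (λ ρ → 𝟙 (i Fin.<? j) * Σᶠ (part j) (term i j ρ))
        ≡⟨ Σᶠ-* (part i) (𝟙 (i Fin.<? j)) _ ⟩
      𝟙 (i Fin.<? j) * Σᶠ (part i) (λ ρ → Σᶠ (part j) (term i j ρ))
        ≡⟨ cong (𝟙 (i Fin.<? j) *_) (quinv₂-toList (column σ i) (column σ j)) ⟩
      𝟙 (i Fin.<? j) * quinv₂ (toList (column σ i)) (toList (column σ j))  ∎

-- Translating between cells and columns

rows-toList : ∀ {P : ℕ → Letter → Set} {m h} (v : Vec Letter h) →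
  (∀ ρ → P (toℕ ρ + m) (lookup v ρ)) → Rows P m (toList v)
rows-toList []      _ = tt
rows-toList {P} {m} (x ∷ v) p =
  p zero , rows-toList v (λ ρ → subst (λ k → P k (lookup v ρ)) (sym (+-suc (toℕ ρ) m)) (p (suc ρ)))

rows-lookup : ∀ {P : ℕ → Letter → Set} {m h} (v : Vec Letter h) →
  Rows P m (toList v) → ∀ ρ → P (toℕ ρ + m) (lookup v ρ)
rows-lookup (x ∷ v) (p , ps) zero = p
rows-lookup {P} {m} (x ∷ v) (p , ps) (suc ρ) =
  subst (λ k → P k (lookup v ρ)) (+-suc (toℕ ρ) m) (rows-lookup v ps ρ)

last-toList : ∀ {h} (v : Vec Letter h) ρ → suc (toℕ ρ) ≡ h → last (toList v) ≡ just (lookup v ρ)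
last-toList (x ∷ [])    zero    _  = refl
last-toList (x ∷ y ∷ v) (suc ρ) eq = last-toList (y ∷ v) ρ (suc-injective eq)

topIndex : ∀ {h} → 0 < h → ∃[ ρ ] suc (toℕ {h} ρ) ≡ h
topIndex {suc h} _ = fromℕ h , cong suc (Fin.toℕ-fromℕ h)

columns-all⁺ : ∀ {P : Column → Set} {hs} (σ : All (Vec Letter) hs) →
  (∀ i → P (toList (column σ i))) → All P (columns σ)
columns-all⁺ []      _ = []
columns-all⁺ (v ∷ σ) p = p zero ∷ columns-all⁺ σ (p ∘ suc)

columns-all⁻ : ∀ {P : Column → Set} {hs} (σ : All (Vec Letter) hs) →
  All P (columns σ) → ∀ i → P (toList (column σ i))
columns-all⁻ (v ∷ σ) (p ∷ ps) zero    = p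
columns-all⁻ (v ∷ σ) (p ∷ ps) (suc i) = columns-all⁻ σ ps i

columns-any⁺ : ∀ {P : Column → Set} {hs} (σ : All (Vec Letter) hs) i →
  P (toList (column σ i)) → Any P (columns σ)
columns-any⁺ (v ∷ σ) zero    p = here p
columns-any⁺ (v ∷ σ) (suc i) p = there (columns-any⁺ σ i p)

columns-any⁻ : ∀ {P : Column → Set} {hs} (σ : All (Vec Letter) hs) →
  Any P (columns σ) → ∃[ i ] P (toList (column σ i))
columns-any⁻ (v ∷ σ) (here p)  = zero , p
columns-any⁻ (v ∷ σ) (there p) = let i , q = columns-any⁻ σ p in suc i , q

lookup-antitone : ∀ {hs} → AllPairs _≥_ hs → ∀ {i j} → i Fin.< j → List.lookup hs j ≤ List.lookup hs i
lookup-antitone {hs = _ ∷ hs} (h≥ AllPairs.∷ _) {zero} {suc j} _ = All.lookup h≥ (∈-lookup j)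
lookup-antitone (_ AllPairs.∷ pairs) {suc i} {suc j} lt = lookup-antitone pairs (s≤s⁻¹ lt)

largest : ∀ {n} {P : Fin n → Set} → (∀ i → Dec (P i)) → ∃ P → ∃[ i ] P i × (∀ j → i Fin.< j → ¬ P j)
largest {suc n} {P} P? (i , p) with Fin.any? (P? ∘ suc)
... | yes q = let j , r , max = largest (P? ∘ suc) q in
  suc j , r , λ { (suc k) lt → max k (s≤s⁻¹ lt) }
... | no ¬q with i | p
...   | zero  | p₀ = zero , p₀ , λ { (suc k) _ r → ¬q (k , r) }
...   | suc j | pⱼ = contradiction (j , pⱼ) ¬q

-- Degenerate fillings and the involution on them

module Degenerate (μ : Partition) where

  open Partition μ
  open Statistics μ

  pairs : AllPairs _≥_ parts
  pairs = Linked.Linked⇒AllPairs (λ x≥y y≥z → ≤-trans y≥z x≥y) decreasing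

  height-antitone : ∀ (u v : Cell μ) → col μ u Fin.< col μ v → height μ v ≤ height μ u
  height-antitone u v = lookup-antitone pairs

  row≤height : ∀ (u : Cell μ) → row μ u ≤ height μ u
  row≤height (i , ρ) = Fin.toℕ<n ρ

  cell-≡ : ∀ {u v : Cell μ} → col μ u ≡ col μ v → row μ u ≡ row μ v → u ≡ v
  cell-≡ {i , ρ} {_ , ρ′} refl eq = cong (i ,_) (Fin.toℕ-injective (suc-injective eq))

  -- Heights weakly decrease to the right, so the right cell of a degenerate triple tops its column
  -- as well. Whichever of the two is distinguished, it is a top cell.
  degenerate-height : ∀ {v w} → DegenerateTriple μ v w → height μ w ≡ row μ w
  degenerate-height {v} {w} ((row≡ , lt) , hv) = ≤-antisym
    (≤-trans (height-antitone v w lt) (≤-reflexive (trans hv row≡))) (row≤height w)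

  -- A form of degeneracy that the involution visibly preserves: rows and absolute values, some mark
  -- in the block, and a condition on the shape alone. It does not single out the column of the
  -- distinguished cell, which may change when a mark moves.
  record DegenerateAt (n r : ℕ) (σ : Filling μ) : Set where
    field
      n<r : suc n < r
    open Distinguished n r n<r
    field
      admissible : All Admissibleᶜ (columns σ)
      witness    : Any (λ c → length c ≡ r × Marked c) (columns σ)
      triple     : ∃[ v ] ∃[ w ] DegenerateTriple μ v w × row μ v ≡ r

  admissible-cell : ∀ {P : ℕ → Letter → Set} {σ} → All (Rows P 1) (columns σ) → ∀ u → P (row μ u) (_⟨_⟩ μ σ u)
  admissible-cell {P} {σ} ad (i , ρ) =
    subst (λ k → P k (lookup (column σ i) ρ)) (+-comm (toℕ ρ) 1) (rows-lookup (column σ i) (columns-all⁻ σ ad i) ρ)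

  cell-admissible : ∀ {P : ℕ → Letter → Set} σ → (∀ u → P (row μ u) (_⟨_⟩ μ σ u)) → All (Rows P 1) (columns σ)
  cell-admissible {P} σ p = columns-all⁺ σ λ i → rows-toList (column σ i)
    (λ ρ → subst (λ k → P k (lookup (column σ i) ρ)) (+-comm 1 (toℕ ρ)) (p (i , ρ)))

  ∣∣>0 : ∀ x → 0 < ∣ x ∣
  ∣∣>0 (pos _) = s≤s z≤n
  ∣∣>0 (neg _) = s≤s z≤n

  Φdegenerate⇒at : ∀ {σ} → ΦDegenerate μ σ → ∃[ n ] ∃[ r ] DegenerateAt n r σ
  Φdegenerate⇒at {σ} (u , (suc n , ((_ , v , ∣v∣ , n<v) , least) , ∣u∣ , first) , v₀ , w₀ , tr@((row≡ , _) , hv) , u∈) =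
    n , row μ u , record
    { n<r = n<u
    ; admissible = cell-admissible σ λ w →
        (λ w<n → ≮⇒≥ λ w< → least w<n (∣∣>0 (_⟨_⟩ μ σ w) , w , refl , w<)) ,
        (λ ∣w∣ → ≮⇒≥ λ u<w → first w (inj₁ u<w) ∣w∣)
    ; witness = columns-any⁺ σ (proj₁ u)
        ( trans (length-toList (column σ (proj₁ u))) (hu u∈)
        , trans (cong (Maybe.map ∣_∣) (last-toList (column σ (proj₁ u)) (proj₂ u) (sym (hu u∈)))) (cong just ∣u∣))
    ; triple = v₀ , w₀ , tr , v₀-row u∈ }
    where
    -- The cell v that makes n + 1 a candidate may differ from u, but u comes first in reading order
    -- and hence lies in no lower row.
    n<u : suc n < row μ u
    n<u = <-≤-trans n<v (≮⇒≥ λ u<v → first v (inj₁ u<v) ∣v∣)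
    hu : u ≡ v₀ ⊎ u ≡ w₀ → height μ u ≡ row μ u
    hu (inj₁ refl) = hv
    hu (inj₂ refl) = degenerate-height tr
    v₀-row : u ≡ v₀ ⊎ u ≡ w₀ → row μ v₀ ≡ row μ u
    v₀-row (inj₁ refl) = refl
    v₀-row (inj₂ refl) = row≡

  topCell : ∀ {n r σ} → DegenerateAt n r σ →
    ∃[ u ] row μ u ≡ height μ u × height μ u ≡ r × ∣ _⟨_⟩ μ σ u ∣ ≡ suc n
  topCell {σ = σ} d =
    let i , ∣c∣ , marked = columns-any⁻ σ witness
        partᵢ = trans (sym (length-toList (column σ i))) ∣c∣
        ρ , eq = topIndex (subst (0 <_) (sym partᵢ) (≤-trans (s≤s z≤n) n<r))
    in (i , ρ) , eq , partᵢ , Maybe.just-injective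
         (trans (cong (Maybe.map ∣_∣) (sym (last-toList (column σ i) ρ eq))) marked)
    where open DegenerateAt d

  cell-ok : ∀ {n r σ} (d : DegenerateAt n r σ) → ∀ u →
    Distinguished.Admissible n r (DegenerateAt.n<r d) (row μ u) (_⟨_⟩ μ σ u)
  cell-ok {σ = σ} d = admissible-cell {σ = σ} (DegenerateAt.admissible d)

  -- Rows are read from right to left, so the distinguished cell is the top of the rightmost marked
  -- column of the block. It forms a degenerate triple with the cell v of `triple`, on whichever
  -- side v lies; if it is v itself, w completes the triple.
  at⇒Φdegenerate : ∀ {n r σ} → DegenerateAt n r σ → ΦDegenerate μ σ
  at⇒Φdegenerate {n} {r} {σ} d = result (largest top? (let (i , ρ) , eqs = topCell d in i , ρ , eqs))
    where
    open DegenerateAt d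
    open Distinguished n r n<r

    Top : Fin #columns → Set
    Top i = ∃[ ρ ] suc (toℕ ρ) ≡ part i × part i ≡ r × ∣ _⟨_⟩ μ σ (i , ρ) ∣ ≡ suc n

    top? : ∀ i → Dec (Top i)
    top? i = Fin.any? λ ρ → (suc (toℕ ρ) ≟ part i) ×-dec (part i ≟ r) ×-dec (∣ _⟨_⟩ μ σ (i , ρ) ∣ ≟ suc n)

    result : ∃[ i ] Top i × (∀ j → i Fin.< j → ¬ Top j) → ΦDegenerate μ σ
    result (i , (ρ , row≡part , part≡r , ∣u∣) , rightmost) =
      u , (suc n , ((s≤s z≤n , u , ∣u∣ , subst (suc n <_) (sym row≡r) n<r) , least) , ∣u∣ , first) ,
      inTriple triple
      where
      u : Cell μ
      u = i , ρ
      row≡r : row μ u ≡ r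
      row≡r = trans row≡part part≡r
      least : ∀ {b} → b < suc n → ¬ LabelCandidate μ σ b
      least b<n (_ , v , refl , b<v) = <⇒≱ b<v (proj₁ (cell-ok d v) b<n)
      first : ∀ v → _≺_ μ v u → ∣ _⟨_⟩ μ σ v ∣ ≢ suc n
      first v (inj₁ u<v) ∣v∣ = <⇒≱ (subst (_< row μ v) row≡r u<v) (proj₂ (cell-ok d v) ∣v∣)
      first v@(j , ρ′) (inj₂ (row≡ , i<j)) ∣v∣ = rightmost j i<j
        (ρ′ , trans row≡r′ (sym part≡r′) , part≡r′ , ∣v∣)
        where
        row≡r′ : row μ v ≡ r
        row≡r′ = trans row≡ row≡r
        part≡r′ : part j ≡ r
        part≡r′ = ≤-antisym (≤-trans (height-antitone u v i<j) (≤-reflexive part≡r))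
          (≤-trans (≤-reflexive (sym row≡r′)) (row≤height v))
      inTriple : (∃[ v ] ∃[ w ] DegenerateTriple μ v w × row μ v ≡ r) → InDegenerateTriple μ u
      inTriple (v , w , tr@(_ , hv) , row-v) with Fin.<-cmp (col μ u) (col μ v)
      ... | tri< lt _ _ = u , v , ((trans row≡r (sym row-v) , lt) , sym row≡part) , inj₁ refl
      ... | tri> _ _ gt = v , u , ((trans row-v (sym row≡r) , gt) , hv) , inj₂ refl
      ... | tri≈ _ eq _ = v , w , tr , inj₁ (cell-≡ eq (trans row≡r (sym row-v)))

  label-≮ : ∀ {n r n′ r′ σ} → DegenerateAt n r σ → DegenerateAt n′ r′ σ → ¬ n < n′
  label-≮ d d′ n<n′ = let u , eq₁ , eq₂ , ∣u∣ = topCell d in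
    <⇒≱ (DegenerateAt.n<r d)
      (subst₂ _≤_ (trans eq₁ eq₂) ∣u∣ (proj₁ (cell-ok d′ u) (subst (_< _) (sym ∣u∣) (s≤s n<n′))))

  -- The marked top cell of either description, tested against the admissibility of the other, rules
  -- out a smaller label and a higher row.
  at-unique : ∀ {n r n′ r′ σ} → DegenerateAt n r σ → DegenerateAt n′ r′ σ → n ≡ n′ × r ≡ r′
  at-unique {n} {r} {n′} {r′} {σ} d d′ with <-cmp n n′
  ... | tri< n<n′ _ _ = contradiction n<n′ (label-≮ d d′)
  ... | tri> _ _ n′<n = contradiction n′<n (label-≮ d′ d)
  ... | tri≈ _ refl _ = refl , ≤-antisym (row-≤ d d′) (row-≤ d′ d)
    where
    row-≤ : ∀ {r r′} → DegenerateAt n r σ → DegenerateAt n r′ σ → r ≤ r′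
    row-≤ d d′ = let u , eq₁ , eq₂ , ∣u∣ = topCell d in
      subst (_≤ _) (trans eq₁ eq₂) (proj₂ (cell-ok d′ u) ∣u∣)

  -- Both orientations of `Partner` are joined into one relation. It is total on degenerate
  -- fillings, symmetric and functional, that is, the graph of an involution.
  _~_ : Filling μ → Filling μ → Set
  σ ~ τ = ∃[ n ] ∃[ r ] Σ[ d ∈ DegenerateAt n r σ ]
    let open Distinguished n r (DegenerateAt.n<r d) in
    Partner (columns σ) (columns τ) ⊎ Partner (columns τ) (columns σ)

  ~-exists : ∀ {n r σ} → DegenerateAt n r σ → ∃[ τ ] σ ~ τ
  ~-exists {n} {r} {σ} d with Distinguished.partner-exists n r n<r columns-antitone witness
    where
    open DegenerateAt d
    columns-antitone : AllPairs (λ c e → length e ≤ length c) (columns σ)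
    columns-antitone = AllPairs.map⁻ (subst (AllPairs _≥_) (sym (columns-length σ)) pairs)
  ... | inj₁ (cs , p) with columns-surjective cs (trans (Distinguished.partner-length n r _ p) (columns-length σ))
  ...   | τ , refl = τ , n , r , d , inj₁ p
  ~-exists {n} {r} {σ} d | inj₂ (cs , p)
    with columns-surjective cs (trans (sym (Distinguished.partner-length n r _ p)) (columns-length σ))
  ...   | τ , refl = τ , n , r , d , inj₂ p

  ~-sym : ∀ {σ τ} → σ ~ τ → τ ~ σ
  ~-sym (n , r , d , inj₁ p) = n , r , record
    { n<r = n<r ; admissible = partner-rows⁻ p (λ h → h) admissible ; witness = partner-any⁻ p ; triple = triple } , inj₂ p
    where
    open DegenerateAt d
    open Distinguished n r n<r
  ~-sym (n , r , d , inj₂ p) = n , r , record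
    { n<r = n<r ; admissible = partner-rows⁺ p (λ h → h) admissible ; witness = partner-any⁺ p ; triple = triple } , inj₁ p
    where
    open DegenerateAt d
    open Distinguished n r n<r

  ~-functional : ∀ {σ τ τ′} → σ ~ τ → σ ~ τ′ → τ ≡ τ′
  ~-functional {σ} {τ} {τ′} (n , r , d , p) (n′ , r′ , d′ , p′) with at-unique d d′
  -- `Partner` depends on the proof of `n<r`, so the two proofs are identified before the partners
  -- are compared.
  ... | refl , refl with ≤-irrelevant (DegenerateAt.n<r d) (DegenerateAt.n<r d′)
  ... | eq = columns-injective τ τ′ (agree p (subst (λ lt → Distinguished.Partner n r lt (columns σ) (columns τ′)
                                                    ⊎ Distinguished.Partner n r lt (columns τ′) (columns σ)) (sym eq) p′))
    where
    open Distinguished n r (DegenerateAt.n<r d)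
    agree : Partner (columns σ) (columns τ) ⊎ Partner (columns τ) (columns σ) →
      Partner (columns σ) (columns τ′) ⊎ Partner (columns τ′) (columns σ) → columns τ ≡ columns τ′
    agree (inj₁ p) (inj₁ p′) = partner-functional p p′
    agree (inj₁ p) (inj₂ p′) = contradiction p′ (partner-antisym p)
    agree (inj₂ p) (inj₁ p′) = contradiction p (partner-antisym p′)
    agree (inj₂ p) (inj₂ p′) = partner-injective p p′

  module _ {n r : ℕ} (n<r : suc n < r) (σ τ : Filling μ)
           (partner : Distinguished.Partner n r n<r (columns σ) (columns τ)) where

    open Distinguished n r n<r

    partner-m : m μ τ ≡ suc (m μ σ)
    partner-m = begin
      m μ τ                                    ≡⟨ count-columns negative? τ ⟩
      totalᶜ (𝟙 ∘ negative?) (columns τ)       ≡⟨ +-identityʳ _ ⟨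
      totalᶜ (𝟙 ∘ negative?) (columns τ) + 0   ≡⟨ partner-total partner (𝟙 ∘ negative?) ⟩
      totalᶜ (𝟙 ∘ negative?) (columns σ) + 1   ≡⟨ +-comm _ 1 ⟩
      suc (totalᶜ (𝟙 ∘ negative?) (columns σ)) ≡⟨ cong suc (count-columns negative? σ) ⟨
      suc (m μ σ)                              ∎
      where open ≡-Reasoning

    partner-p : suc (p μ τ) ≡ p μ σ
    partner-p = begin
      suc (p μ τ)                              ≡⟨ cong suc (count-columns positive? τ) ⟩
      suc (totalᶜ (𝟙 ∘ positive?) (columns τ)) ≡⟨ +-comm 1 _ ⟩
      totalᶜ (𝟙 ∘ positive?) (columns τ) + 1   ≡⟨ partner-total partner (𝟙 ∘ positive?) ⟩
      totalᶜ (𝟙 ∘ positive?) (columns σ) + 0   ≡⟨ +-identityʳ _ ⟩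
      totalᶜ (𝟙 ∘ positive?) (columns σ)       ≡⟨ count-columns positive? σ ⟨
      p μ σ                                    ∎
      where open ≡-Reasoning

    partner-xExponent : ∀ k → xExponent μ τ k ≡ xExponent μ σ k
    partner-xExponent k = begin
      xExponent μ τ k                                   ≡⟨ count-columns (λ x → ∣ x ∣ ≟ k) τ ⟩
      totalᶜ (λ x → 𝟙 (∣ x ∣ ≟ k)) (columns τ)          ≡⟨ +-cancelʳ-≡ (𝟙 (suc n ≟ k)) _ _ (partner-total partner _) ⟩
      totalᶜ (λ x → 𝟙 (∣ x ∣ ≟ k)) (columns σ)          ≡⟨ count-columns (λ x → ∣ x ∣ ≟ k) σ ⟨
      xExponent μ σ k                                   ∎
      where open ≡-Reasoning

    module _ (ad : All Admissibleᶜ (columns σ)) where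

      partner-qdeg : p μ τ + maj μ τ ≡ p μ σ + maj μ σ
      partner-qdeg = begin
        p μ τ + maj μ τ                    ≡⟨ cong (p μ τ +_) (trans (maj-columns τ) (partner-maj partner ad)) ⟩
        p μ τ + suc (majᶜ (columns σ))     ≡⟨ +-suc (p μ τ) _ ⟩
        suc (p μ τ) + majᶜ (columns σ)     ≡⟨ cong₂ _+_ partner-p (sym (maj-columns σ)) ⟩
        p μ σ + maj μ σ                    ∎
        where open ≡-Reasoning

      partner-tdeg : quinv μ τ ≡ quinv μ σ
      partner-tdeg = trans (quinv-columns τ) (trans (partner-quinv partner ad) (sym (quinv-columns σ)))

  ~-monomial : ∀ {σ τ ν} → σ ~ τ → HasMonomial μ σ ν → HasMonomial μ τ ν
  ~-monomial {σ} {τ} {ν} (n , r , d , inj₁ pt) (q , t , x , bounded) =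
    trans (partner-qdeg n<r σ τ pt admissible) q ,
    trans (partner-tdeg n<r σ τ pt admissible) t ,
    (λ k → trans (partner-xExponent n<r σ τ pt _) (x k)) ,
    admissible-cell {σ = τ} (partner-rows⁻ pt {λ _ x → ∣ x ∣ ≤ nvars ν} (λ h → h) (cell-admissible σ bounded))
    where
    open DegenerateAt d
    open Distinguished n r n<r
  ~-monomial {σ} {τ} {ν} (n , r , d , inj₂ pt) (q , t , x , bounded) =
    trans (sym (partner-qdeg n<r τ σ pt admissible′)) q ,
    trans (sym (partner-tdeg n<r τ σ pt admissible′)) t ,
    (λ k → trans (sym (partner-xExponent n<r τ σ pt _)) (x k)) ,
    admissible-cell {σ = τ} (partner-rows⁺ pt {λ _ x → ∣ x ∣ ≤ nvars ν} (λ h → h) (cell-admissible σ bounded))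
    where
    open DegenerateAt d
    open Distinguished n r n<r
    admissible′ : All Admissibleᶜ (columns τ)
    admissible′ = partner-rows⁺ pt (λ h → h) admissible

  sign : Filling μ → ℤ
  sign σ = -1ℤ ℤ.^ m μ σ

  ~-sign : ∀ {σ τ} → σ ~ τ → sign τ ≡ ℤ.- sign σ
  ~-sign {σ} {τ} (n , r , d , inj₁ pt) =
    trans (cong (-1ℤ ℤ.^_) (partner-m (DegenerateAt.n<r d) σ τ pt)) (ℤ.-1*i≡-i (sign σ))
  ~-sign {σ} {τ} (n , r , d , inj₂ pt) = sym (trans (cong ℤ.-_ (trans
    (cong (-1ℤ ℤ.^_) (partner-m (DegenerateAt.n<r d) τ σ pt)) (ℤ.-1*i≡-i (sign τ)))) (ℤ.neg-involutive (sign τ)))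

  Φdegenerate⇒~ : ∀ σ → ΦDegenerate μ σ → ∃[ τ ] σ ~ τ
  Φdegenerate⇒~ σ d = let _ , _ , at = Φdegenerate⇒at {σ} d in ~-exists at

  partnerOf : Filling μ → Filling μ
  partnerOf σ with Φdegenerate? μ σ
  ... | yes d = proj₁ (Φdegenerate⇒~ σ d)
  -- A default value: the sum ranges over degenerate fillings only.
  ... | no _  = σ

  ~-partnerOf : ∀ {σ} → ΦDegenerate μ σ → σ ~ partnerOf σ
  ~-partnerOf {σ} d with Φdegenerate? μ σ
  ... | yes d′ = proj₂ (Φdegenerate⇒~ σ d′)
  ... | no ¬d  = contradiction d ¬d

mainTheorem12 : (μ : Partition) (ν : Monomial) → signedSum μ (Φdegenerate? μ) ν ≡ 0ℤ
mainTheorem12 μ ν = sum-involution sign partnerOf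
  (Unique.filter⁺ P? (fillingsUpTo-unique μ (nvars ν))) closed involutive (λ σ∈ → ~-sign (related σ∈))
  where
  open Degenerate μ
  P? : ∀ σ → Dec (ΦDegenerate μ σ × HasMonomial μ σ ν)
  P? σ = Φdegenerate? μ σ ×-dec hasMonomial? μ σ ν
  L : List (Filling μ)
  L = filter P? (fillingsUpTo μ (nvars ν))
  related : ∀ {σ} → σ ∈ L → σ ~ partnerOf σ
  related σ∈ = ~-partnerOf (proj₁ (proj₂ (∈-filter⁻ P? {xs = fillingsUpTo μ (nvars ν)} σ∈)))
  closed : ∀ {σ} → σ ∈ L → partnerOf σ ∈ L
  closed {σ} σ∈ =
    let σ~τ = related σ∈
        _ , _ , d , _ = ~-sym σ~τ
        mon = ~-monomial {ν = ν} σ~τ (proj₂ (proj₂ (∈-filter⁻ P? {xs = fillingsUpTo μ (nvars ν)} σ∈)))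
    -- Having the monomial ν includes the bound `nvars ν` on the entries, so the partner is in the
    -- same finite list.
    in ∈-filter⁺ P? (∈-fillingsUpTo μ (partnerOf σ) {ν} mon) (at⇒Φdegenerate d , mon)
  involutive : ∀ {σ} → σ ∈ L → partnerOf (partnerOf σ) ≡ σ
  involutive σ∈ = ~-functional (related (closed σ∈)) (~-sym (related σ∈))
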